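{- Let $T\in\mathcal{GT}_k(n)$ with $k\ge1$, and put $q_i=q_i(T)$ for $1\le i\le k$. Then the normal form of $\omega(T)$ in $Pl^{\mathbb N}(C_n)$ (equivalently, in the convergent polygraph $\mathbf{ACol}$) is $$[\omega(T)]=\prod_{i=0}^{k-1}\mathfrak{c}(q_{k-i})=\mathfrak{c}(q_k)\,\mathfrak{c}(q_{k-1})\cdots\mathfrak{c}(q_1).$$
   Context: Type $C$ setting: $C_n=\{1<\cdots<n<\overline n<\cdots<\overline1\}$; a column is a strictly increasing word; for a column $u$, $N_z(u)$ is the number of letters $x\le z$ or $x\ge\overline z$; admissible columns are nonempty columns with $N_z(u)\le z$ for all $z$. $\preceq$, tableau words, $Pl(C_n)$ and column insertion are the standard type $C$ notions (Lecouvey). $\mathrm{ACol}(C_n)$ is the set of admissible columns plus a symbol $\epsilon$ ("empty column"); $\mathbf{ACol}$ is the convergent 2-polygraph with generators $\mathrm{ACol}(C_n)$ and rules $c_1c_2\Rightarrow(c_1\leftarrow c_2)$ whenever $c_2\not\preceq c_1$, where $c\preceq\epsilon$ for all $c$, $\epsilon\not\preceq c$ for $c\ne\epsilon$, and $(c_1\leftarrow c_2)$ is $d_1d_2$, $\epsilon d$ or $\epsilon\epsilon$ according as the tableau word of the letters of $c_1c_2$ is $d_1d_2$, one column $d$, or empty. $Pl^{\mathbb N}(C_n)$ is the monoid it presents; $[w]$ is the normal form. Blocks: $\mathfrak{c}(m)=12\cdots m$ for $m\ge1$ and $\mathfrak{c}(0)=\epsilon$; $\mathfrak{c}(a,b)=(a+1)(a+2)\cdots(a+b)$;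 $\mathfrak{c}(\overline a,c)=\overline a\,\overline{a-1}\cdots\overline{a-c+1}$ (empty if $b=0$, resp. $c=0$). $C$-trees: vertices are the symbols $i$ ($i\ge1$), $im$ ("outer") and $im^-$ ("inner") for $i,m\ge1$; vertex $i$ has level $i$ and $im$, $im^-$ have level $i+m$; the strand $i$ consists of $i<i1<i1^-<i2<i2^-<\cdots$ (totally ordered). A labelling of rank $k$ is a map $s$ from the vertices of level $\le k$ to $\mathbb N$. Its valuation is $q(v)=s(i)+\sum_{im\le v}s(im)-\sum_{im^-\le v}s(im^-)$ for $v$ on strand $i$. It is an $n$-labelling if $0\le q(v)\le n$ for all vertices $v$ of level $\le k$. Blocks of vertices: $\rho(i)=\mathfrak{c}(s(i))$ (empty if $s(i)=0$); $\rho(im)=\mathfrak{c}(q(v'),s(im))$ where $v'$ is the predecessor of $im$ on strand $i$ (i.e. $v'=i$ if $m=1$, $v'=i(m-1)^-$ otherwise); $\rho(im^-)=\mathfrak{c}(\overline{q(im)},s(im^-))$. The reading of level $t$ is the word $\omega_t=\rho(t)\,\rho((t-1)1)\,\rho((t-2)2)\cdots\rho(1(t-1))\,\rho(1(t-1)^-)\,\rho(2(t-2)^-)\cdots\rho((t-1)1^-)$, taken to be the letter $\epsilon$ if it is the empty word. $\mathcal{GT}_k(n)$ is the set of $n$-labellings $T$ of rank $k$ such that every $\omega_t$, $1\le t\le k$, is $\epsilon$ or an admissible column; for such $T$, $\omega(T)=\omega_1\omega_2\cdots\omega_k\in\mathrm{ACol}(C_n)^*$. For $T$ of rank $k$ set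 $q_i(T)=q(i(k-i)^-)$ for $1\le i\le k-1$ and $q_k(T)=q(k)=s(k)$.
   Formalization: As a word the product need not be irreducible (n=1, k=2, s(2)=1, other labels 0 gives 𝔠(1)ε), so it is proved that ω(T) and 𝔠(q_k)⋯𝔠(q_1) have the same normal form, and that this is the product itself when q_k ≤ ⋯ ≤ q_1. -}

module Defs where

open import Data.Bool.Base using (if_then_else_)
open import Data.Empty using (⊥)
open import Data.Fin.Base using (Fin; toℕ)
open import Data.Fin.Properties using (toℕ<n)
open import Data.Integer.Base as ℤ using (ℤ; +_; _⊖_; ∣_∣)
import Data.Integer.Properties as ℤ
open import Data.List.Base using (List; []; _∷_; _++_; concatMap; downFrom; filter; length; map; tabulate)
open import Data.List.Properties using (filter-accept; filter-reject)
import Data.List.Membership.DecPropositional as DecMembership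
import Data.List.Membership.Propositional as Membership
open import Data.List.Relation.Binary.Prefix.Heterogeneous using (Prefix)
open import Data.List.Relation.Unary.All using (All; []; _∷_)
open import Data.List.Relation.Unary.Linked using (Linked; []; [-]; _∷_)
import Data.List.Sort.InsertionSort as InsertionSort
open import Data.Nat.Base using (ℕ; zero; suc; pred; _+_; _∸_; _⊓_; _≤_; _<_; z≤n; s≤s; NonZero; >-nonZero)
open import Data.Nat.Properties
open import Data.Product.Base using (_×_; _,_)
open import Data.Sum.Base using (_⊎_; inj₁; inj₂; swap)
open import Data.Sum.Properties using (≡-dec)
open import Data.Sum.Relation.Binary.LeftOrder using (_⊎-<_; ₁∼₂; ₁∼₁; ₂∼₂; ⊎-<-decTotalOrder)
open import Data.Unit.Base using (⊤)
open import Function.Base using (flip)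
open import Level using (0ℓ)
open import Relation.Binary.Bundles using (DecTotalOrder)
open import Relation.Binary.Construct.Closure.Equivalence using (EqClosure)
open import Relation.Binary.Construct.Closure.ReflexiveTransitive using (Star)
import Relation.Binary.Construct.Flip.EqAndOrd as Flip
open import Relation.Binary.PropositionalEquality using (_≡_; _≢_; refl; sym; trans; cong; subst)
open import Relation.Binary.Rewriting using (IsNormalForm)
open import Relation.Nullary using (¬_; Dec; yes; no; contradiction)
open import Relation.Nullary.Decidable using (does; ¬?; _×-dec_; _⊎-dec_)

------------------------------------------------------------------------
-- Letters, words and columns

-- The order 1 < 2 < ⋯ < 2̄ < 1̄ does not involve n, so a letter is a bare
-- (un)barred number, and 𝒞ₙ is cut out by InAlphabet n.
Letter : Set
Letter = ℕ ⊎ ℕ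

pattern pos i = inj₁ i
pattern bar i = inj₂ i

Word : Set
Word = List Letter

letterOrder : DecTotalOrder 0ℓ 0ℓ 0ℓ
letterOrder = ⊎-<-decTotalOrder ≤-decTotalOrder (Flip.decTotalOrder ≤-decTotalOrder)

open DecTotalOrder letterOrder public using () renaming (_≤_ to _≤ₗ_; _≤?_ to _≤ₗ?_)

infix 4 _<ₗ_
_<ₗ_ : Letter → Letter → Set
_<ₗ_ = _<_ ⊎-< flip _<_

open Membership {A = Letter} using (_∈_)
open DecMembership (≡-dec _≟_ _≟_) using (_∈?_)
open InsertionSort letterOrder using (sort)

InAlphabet : ℕ → Letter → Set
InAlphabet n (pos i) = 1 ≤ i × i ≤ n
InAlphabet n (bar i) = 1 ≤ i × i ≤ n

IsColumn : ℕ → Word → Set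
IsColumn n u = All (InAlphabet n) u × Linked _<ₗ_ u

within? : ∀ z x → Dec (x ≤ₗ pos z ⊎ bar z ≤ₗ x)
within? z x = (x ≤ₗ? pos z) ⊎-dec (bar z ≤ₗ? x)

N : ℕ → Word → ℕ
N z u = length (filter (within? z) u)

record IsAdmissible (n : ℕ) (u : Word) : Set where
  constructor mkAdmissible
  field
    nonempty : u ≢ []
    column   : IsColumn n u
    bounded  : ∀ z → 1 ≤ z → z ≤ n → N z u ≤ z

------------------------------------------------------------------------
-- The plactic monoid of type C

-- Lecouvey's relations R₁ (two families), R₂ (two families, stated for
-- x = a + 1) and R₃.  The involution x ↦ x̄ on letters is swap.
data PlacticRelation (n : ℕ) : Word → Word → Set where
  R₁ : ∀ {x y z} → All (InAlphabet n) (x ∷ y ∷ z ∷ []) →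
       x ≤ₗ y → y <ₗ z → z ≢ swap x →
       PlacticRelation n (y ∷ z ∷ x ∷ []) (y ∷ x ∷ z ∷ [])
  R₁′ : ∀ {x y z} → All (InAlphabet n) (x ∷ y ∷ z ∷ []) →
        x <ₗ y → y ≤ₗ z → z ≢ swap x →
        PlacticRelation n (x ∷ z ∷ y ∷ []) (z ∷ x ∷ y ∷ [])
  R₂ : ∀ {a y} → 1 ≤ a → suc a ≤ n → InAlphabet n y →
       pos (suc a) ≤ₗ y → y ≤ₗ bar (suc a) →
       PlacticRelation n (y ∷ bar a ∷ pos a ∷ []) (y ∷ pos (suc a) ∷ bar (suc a) ∷ [])
  R₂′ : ∀ {a y} → 1 ≤ a → suc a ≤ n → InAlphabet n y →
        pos (suc a) ≤ₗ y → y ≤ₗ bar (suc a) →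
        PlacticRelation n (pos (suc a) ∷ bar (suc a) ∷ y ∷ []) (bar a ∷ pos a ∷ y ∷ [])
  R₃ : ∀ {w z} u₁ u₂ u₃ → IsColumn n w → ¬ IsAdmissible n w →
       (∀ p f s → w ≡ p ++ f ++ s → f ≢ [] → f ≢ w → IsAdmissible n f) →
       w ≡ u₁ ++ pos z ∷ u₂ ++ bar z ∷ u₃ → N z w ≡ suc z →
       (∀ z′ → z′ < z → pos z′ ∈ w → bar z′ ∈ w → N z′ w ≢ suc z′) →
       PlacticRelation n w (u₁ ++ u₂ ++ u₃)

data PlacticStep (n : ℕ) : Word → Word → Set where
  step : ∀ p s {u v} → PlacticRelation n u v → PlacticStep n (p ++ u ++ s) (p ++ v ++ s)

-- Equality in Pl(Cₙ).
Plactic : ℕ → Word → Word → Set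
Plactic n = EqClosure (PlacticStep n)

------------------------------------------------------------------------
-- The order on columns

-- The letters z₁ > ⋯ > z_r such that z and z̄ both occur in C.
doubled : ℕ → Word → List ℕ
doubled n C = filter (λ z → (pos z ∈? C) ×-dec (bar z ∈? C)) (downFrom (suc n))

-- The greatest t ≤ b such that neither t nor t̄ occurs in C; the value 0,
-- which is not a letter, means that there is none.
greatestFree : Word → ℕ → ℕ
greatestFree C zero    = zero
greatestFree C (suc t) =
  if does ((pos (suc t) ∈? C) ⊎-dec (bar (suc t) ∈? C)) then greatestFree C t else suc t

-- The letters t₁ > ⋯ > t_r, where t_i is the greatest letter < min(t_{i-1}, z_i)
-- with t_i, t̄_i ∉ C.  They all exist when C is admissible.
partners : Word → ℕ → List ℕ → List ℕ
partners C b []       = []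
partners C b (z ∷ zs) = let t = greatestFree C (pred (b ⊓ z)) in t ∷ partners C t zs

replace : List Letter → List Letter → Word → Word
replace old new C = sort (filter (λ x → ¬? (x ∈? old)) C ++ new)

-- The split form (ℓC, rC): z_i is replaced by t_i in ℓC, and z̄_i by t̄_i in rC.
leftSplit rightSplit : ℕ → Word → Word
leftSplit  n C = replace (map pos zs) (map pos (partners C (suc n) zs)) C
  where zs = doubled n C
rightSplit n C = replace (map bar zs) (map bar (partners C (suc n) zs)) C
  where zs = doubled n C

-- C is at least as long as D, and the rows of the array with columns C, D
-- increase weakly from left to right.
_≤col_ : Word → Word → Set
C ≤col D = Prefix (flip _≤ₗ_) D C

-- Admissible columns and the symbol ε.  Irrelevance of the proof makes two
-- columns with the same letters equal.
data ACol (n : ℕ) : Set where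
  ε   : ACol n
  col : (u : Word) → .(IsAdmissible n u) → ACol n

letters : ∀ {n} → ACol n → Word
letters ε         = []
letters (col u _) = u

infix 4 _⪯_
_⪯_ : ∀ {n} → ACol n → ACol n → Set
_       ⪯ ε       = ⊤
ε       ⪯ col _ _ = ⊥
_⪯_ {n} (col u _) (col v _) = rightSplit n u ≤col leftSplit n v

------------------------------------------------------------------------
-- The polygraph

IsColumnOf : ∀ {n} → ACol n → Set
IsColumnOf ε         = ⊥
IsColumnOf (col _ _) = ⊤

-- ds = d₁ ⋯ d_r is the tableau word of w: the word (columns read from right to
-- left) of a symplectic tableau, equal to w in Pl(Cₙ).  By Lecouvey each word
-- has exactly one, computed by column insertion.
record IsTableauWordOf {n : ℕ} (w : Word) (ds : List (ACol n)) : Set where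
  field
    columns : All IsColumnOf ds
    tableau : Linked (flip _⪯_) ds
    plactic : Plactic n w (concatMap letters ds)

-- Inserted c₁ c₂ r says that r = (c₁ ← c₂).
data Inserted {n : ℕ} (c₁ c₂ : ACol n) : List (ACol n) → Set where
  two  : ∀ {d₁ d₂} → IsTableauWordOf (letters c₁ ++ letters c₂) (d₁ ∷ d₂ ∷ []) →
         Inserted c₁ c₂ (d₁ ∷ d₂ ∷ [])
  one  : ∀ {d} → IsTableauWordOf (letters c₁ ++ letters c₂) (d ∷ []) →
         Inserted c₁ c₂ (ε ∷ d ∷ [])
  none : IsTableauWordOf {n} (letters c₁ ++ letters c₂) [] →
         Inserted c₁ c₂ (ε ∷ ε ∷ [])

infix 4 _⟶_
data _⟶_ {n : ℕ} : List (ACol n) → List (ACol n) → Set where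
  rule : ∀ xs ys {c₁ c₂ r} → ¬ (c₂ ⪯ c₁) → Inserted c₁ c₂ r →
         xs ++ c₁ ∷ c₂ ∷ ys ⟶ xs ++ r ++ ys

-- v = [w].  The polygraph is convergent, so each w has exactly one such v.
_HasNormalForm_ : ∀ {n} → List (ACol n) → List (ACol n) → Set
w HasNormalForm v = Star _⟶_ w v × IsNormalForm _⟶_ v

------------------------------------------------------------------------
-- Blocks

-- 𝔠⁺ a b = (a+1)(a+2)⋯(a+b)
𝔠⁺ : ℕ → ℕ → Word
𝔠⁺ a zero    = []
𝔠⁺ a (suc b) = pos (suc a) ∷ 𝔠⁺ (suc a) b

-- 𝔠⁻ a c is the word of barred letters a, a-1, …, a-c+1.
𝔠⁻ : ℕ → ℕ → Word
𝔠⁻ a zero    = []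
𝔠⁻ a (suc c) = bar a ∷ 𝔠⁻ (pred a) c

toACol : ∀ {n} (u : Word) → .(u ≡ [] ⊎ IsAdmissible n u) → ACol n
toACol         []      _ = ε
toACol {n} u@(_ ∷ _) p = col u (admissible p)
  where
  admissible : ∀ {x v} → x ∷ v ≡ [] ⊎ IsAdmissible n (x ∷ v) → IsAdmissible n (x ∷ v)
  admissible (inj₁ ())
  admissible (inj₂ a) = a

𝔠⁺-alphabet : ∀ {n} a b → a + b ≤ n → All (InAlphabet n) (𝔠⁺ a b)
𝔠⁺-alphabet a zero    p = []
𝔠⁺-alphabet {n} a (suc b) p = (s≤s z≤n , ≤-trans (s≤s (m≤m+n a b)) q) ∷ 𝔠⁺-alphabet (suc a) b q
  where
  q : suc a + b ≤ n
  q = subst (_≤ n) (+-suc a b) p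

𝔠⁺-increasing : ∀ a b → Linked _<ₗ_ (𝔠⁺ a b)
𝔠⁺-increasing a zero          = []
𝔠⁺-increasing a (suc zero)    = [-]
𝔠⁺-increasing a (suc (suc b)) = ₁∼₁ (n<1+n (suc a)) ∷ 𝔠⁺-increasing (suc a) (suc b)

N-𝔠⁺ : ∀ z a b → N z (𝔠⁺ a b) ≤ z ∸ a
N-𝔠⁺ z a zero    = z≤n
N-𝔠⁺ z a (suc b) with suc a ≤? z
... | yes a<z = ≤-trans
  (≤-reflexive (cong length (filter-accept (within? z) {pos (suc a)} {𝔠⁺ (suc a) b} (inj₁ (₁∼₁ a<z)))))
  (≤-trans (s≤s (N-𝔠⁺ z (suc a) b)) (≤-reflexive (sym (+-∸-assoc 1 a<z))))
... | no a≮z = ≤-trans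
  (≤-reflexive (cong length (filter-reject (within? z) {pos (suc a)} {𝔠⁺ (suc a) b}
    λ { (inj₁ (₁∼₁ a<z)) → a≮z a<z })))
  (≤-trans (N-𝔠⁺ z (suc a) b) (∸-monoʳ-≤ z (n≤1+n a)))

𝔠⁺-admissible : ∀ {n} m → m ≤ n → 𝔠⁺ 0 m ≡ [] ⊎ IsAdmissible n (𝔠⁺ 0 m)
𝔠⁺-admissible zero      m≤n = inj₁ refl
𝔠⁺-admissible m@(suc _) m≤n = inj₂ (mkAdmissible (λ ())
  (𝔠⁺-alphabet 0 m m≤n , 𝔠⁺-increasing 0 m) (λ z _ _ → N-𝔠⁺ z 0 m))

-- 𝔠(m) = 12⋯m and 𝔠(0) = ε
𝔠 : ∀ {n} (m : ℕ) → .(m ≤ n) → ACol n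
𝔠 m m≤n = toACol (𝔠⁺ 0 m) (𝔠⁺-admissible m m≤n)

------------------------------------------------------------------------
-- C-trees

data Vertex : Set where
  root        : (i : ℕ) → .⦃ NonZero i ⦄ → Vertex
  outer inner : (i m : ℕ) → .⦃ NonZero i ⦄ → .⦃ NonZero m ⦄ → Vertex

level : Vertex → ℕ
level (root i)    = i
level (outer i m) = i + m
level (inner i m) = i + m

-- The greatest vertex of level ≤ i + m on the strand i.
last : (i m : ℕ) → .⦃ NonZero i ⦄ → Vertex
last i zero      = root i
last i m@(suc _) = inner i m

shorter : ∀ {k} i {m m′} → m′ ≤ m → i + m ≤ k → i + m′ ≤ k
shorter i m′≤m = ≤-trans (+-monoʳ-≤ i m′≤m)

last-level : ∀ {k} i m .⦃ _ : NonZero i ⦄ → i + m ≤ k → level (last i m) ≤ k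
last-level i zero    p = ≤-trans (m≤m+n i 0) p
last-level i (suc m) p = p

Labelling : ℕ → Set
Labelling k = (v : Vertex) → .(level v ≤ k) → ℕ

module _ {k : ℕ} (s : Labelling k) where

  -- s(i1) + ⋯ + s(im) and s(i1⁻) + ⋯ + s(im⁻)
  ∑outer ∑inner : (i m : ℕ) .⦃ _ : NonZero i ⦄ → .(i + m ≤ k) → ℕ
  ∑outer i zero    p = 0
  ∑outer i (suc m) p = ∑outer i m (shorter i (n≤1+n m) p) + s (outer i (suc m)) p
  ∑inner i zero    p = 0
  ∑inner i (suc m) p = ∑inner i m (shorter i (n≤1+n m) p) + s (inner i (suc m)) p

  q : (v : Vertex) → .(level v ≤ k) → ℤ
  q (root i)    p = + s (root i) p
  q (outer i m) p = (s (root i) (≤-trans (m≤m+n i m) p) + ∑outer i m p)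
                    ⊖ ∑inner i (pred m) (shorter i pred[n]≤n p)
  q (inner i m) p = (s (root i) (≤-trans (m≤m+n i m) p) + ∑outer i m p) ⊖ ∑inner i m p

  -- Blocks of vertices.  The predecessor of im is last i (m - 1).  The absolute
  -- values are the valuations themselves as soon as s is an n-labelling.
  ρ : (v : Vertex) → .(level v ≤ k) → Word
  ρ (root i)    p = 𝔠⁺ 0 (s (root i) p)
  ρ (outer i m) p =
    𝔠⁺ ∣ q (last i (pred m)) (last-level i (pred m) (shorter i pred[n]≤n p)) ∣ (s (outer i m) p)
  ρ (inner i m) p = 𝔠⁻ ∣ q (outer i m) p ∣ (s (inner i m) p)

  -- ρ(i(m+1)) ρ((i-1)(m+2)) ⋯ ρ(1(m+i))
  outers : (i m : ℕ) → .(i + suc m ≤ k) → Word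
  outers zero    m p = []
  outers (suc i) m p =
    ρ (outer (suc i) (suc m)) p ++ outers i (suc m) (≤-trans (≤-reflexive (+-suc i (suc m))) p)

  -- ρ(1(m+i)⁻) ⋯ ρ((i-1)(m+2)⁻) ρ(i(m+1)⁻)
  inners : (i m : ℕ) → .(i + suc m ≤ k) → Word
  inners zero    m p = []
  inners (suc i) m p =
    inners i (suc m) (≤-trans (≤-reflexive (+-suc i (suc m))) p) ++ ρ (inner (suc i) (suc m)) p

  ω-level : (t : ℕ) .⦃ _ : NonZero t ⦄ → .(t ≤ k) → Word
  ω-level t p = ρ (root t) p ++ outers (pred t) 0 (bound p) ++ inners (pred t) 0 (bound p)
    where
    bound : t ≤ k → pred t + 1 ≤ k
    bound = ≤-trans (≤-reflexive (trans (+-comm (pred t) 1) (suc-pred t)))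

record GT (k n : ℕ) : Set where
  field
    s         : Labelling k
    valuation : ∀ v (p : level v ≤ k) → ℤ.0ℤ ℤ.≤ q s v p × q s v p ℤ.≤ + n
    columns   : ∀ t .⦃ _ : NonZero t ⦄ (p : t ≤ k) →
                ω-level s t p ≡ [] ⊎ IsAdmissible n (ω-level s t p)

module _ {k n : ℕ} (T : GT k n) where
  open GT T

  -- ω₁ω₂⋯ω_k
  ω : List (ACol n)
  ω = tabulate λ (j : Fin k) →
    toACol (ω-level s (suc (toℕ j)) (toℕ<n j)) (columns (suc (toℕ j)) (toℕ<n j))

  private
    end-level : ∀ i .⦃ _ : NonZero i ⦄ → i ≤ k → level (last i (k ∸ i)) ≤ k
    end-level i i≤k = last-level i (k ∸ i) (≤-reflexive (m+[n∸m]≡n i≤k))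

    ∣∣-bound : ∀ {x} → ℤ.0ℤ ℤ.≤ x × x ℤ.≤ + n → ∣ x ∣ ≤ n
    ∣∣-bound (ℤ.+≤+ _ , x≤n) = ℤ.drop‿+≤+ x≤n

  -- q_i = q(i(k-i)⁻) for i < k, and q_k = q(k).
  qᵢ : (i : ℕ) .⦃ _ : NonZero i ⦄ → .(i ≤ k) → ℤ
  qᵢ i i≤k = q s (last i (k ∸ i)) (end-level i i≤k)

  𝔠qᵢ : (i : ℕ) .⦃ _ : NonZero i ⦄ → .(i ≤ k) → ACol n
  𝔠qᵢ i i≤k = 𝔠 ∣ qᵢ i i≤k ∣ (∣∣-bound (valuation (last i (k ∸ i)) (end-level i i≤k)))

  -- 𝔠(q_k) 𝔠(q_{k-1}) ⋯ 𝔠(q₁)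
  ∏𝔠q : List (ACol n)
  ∏𝔠q = tabulate λ (j : Fin k) →
    𝔠qᵢ (k ∸ toℕ j) ⦃ >-nonZero (m<n⇒0<n∸m (toℕ<n j)) ⦄ (m∸n≤m k (toℕ j))

{-# OPTIONS --safe #-}
-- Record a sorted product 𝔠(p₁)⋯𝔠(p_t), p₁ ≤ ⋯ ≤ p_t, by its multiset of heights.
-- A column u inserted from the right splits as X (p_t+1)⋯m B̄ with letters X ≤ p_t
-- and bars B̄ from B ⊆ [1, m].  Since 𝔠(p) x ≡ x 𝔠(p) for x ≤ p, and since R₃ lets each bar
-- delete its letter from 12⋯m, one has 𝔠(p_t) u ≡ X D with D = [1, m] ∖ B; admissibility of
-- u says exactly that X D is a tableau.  Both X and D are unbarred, and inserting
-- an unbarred column needs no contraction and leaves a sorted product again.  The effect on the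
-- heights is that the letter i+1 turns some height i into i+1 and the bar of i
-- turns some height i into i-1, which for ω_t is what the strands of the C-tree record.
-- A product of columns 𝔠(q) with the same heights is sorted by the same insertion.
module Submission where

open import Defs
open import Data.Fin.Base using (Fin; toℕ)
open import Data.Fin.Properties using (toℕ<n)
open import Data.Integer.Base as ℤ using ()
import Data.Integer.Properties as ℤ
open import Data.List.Base using (List; []; _∷_; _++_; map; filter; length; tabulate; initLast; _∷ʳ′_)
open import Data.List.Properties
  using (filter-all; filter-none; filter-accept; filter-reject; filter-++; map-++; length-map; length-++;
         ++-assoc; ++-identityʳ; ∷-injectiveʳ; ∷ʳ-injectiveˡ)
import Data.List.Membership.DecPropositional as DecMembership
open import Data.List.Membership.Propositional using (_∈_; _∉_)
open import Data.List.Membership.Propositional.Properties using (∈-map⁻; ∈-++⁺ˡ; ∈-++⁺ʳ; ∈-++⁻)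
open import Data.List.Relation.Binary.Permutation.Propositional.Properties using (filter-↭; ↭-length)
open import Data.List.Relation.Binary.Prefix.Heterogeneous using (Prefix; []; _∷_)
open import Data.List.Relation.Unary.All as All using (All; []; _∷_)
import Data.List.Relation.Unary.All.Properties as All
open import Data.List.Relation.Unary.AllPairs as AllPairs using (AllPairs; []; _∷_)
import Data.List.Relation.Unary.AllPairs.Properties as AllPairs
open import Data.List.Relation.Unary.Any using (here; there)
open import Data.List.Relation.Unary.Linked as Linked using (Linked; []; [-]; _∷_)
import Data.List.Relation.Unary.Linked.Properties as Linked
import Data.List.Sort.InsertionSort as InsertionSort
open import Data.List.Sort.InsertionSort.Properties letterOrder using (sort-↭)
open import Data.Nat.Base
open import Data.Nat.Properties
open import Algebra.Properties.CommutativeSemigroup +-commutativeSemigroup using (x∙yz≈y∙xz; interchange)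
open import Data.Nat.Tactic.RingSolver using (solve-∀)
open import Data.Product.Base using (_×_; _,_; proj₁; proj₂; ∃-syntax)
open import Data.Sum.Base using (_⊎_; inj₁; inj₂)
open import Data.Sum.Properties using (≡-dec)
open import Data.Sum.Relation.Binary.LeftOrder using (₁∼₂; ₁∼₁; ₂∼₂; ⊎-<-transitive)
open import Function.Base using (_∘_; case_of_; flip)
open import Relation.Binary.Bundles using (DecTotalOrder)
open import Relation.Binary.Construct.Closure.Equivalence as EqClosure using ()
open import Relation.Binary.Construct.Closure.ReflexiveTransitive as Star using (Star; _◅_; _◅◅_)
open import Relation.Binary.Core using (Rel)
open import Relation.Binary.PropositionalEquality
open import Relation.Binary.Rewriting using (IsNormalForm)
open import Relation.Nullary using (¬_; yes; no; contradiction)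
open import Relation.Nullary.Decidable using (¬?; _×-dec_; dec-true; recompute)
open import Relation.Unary using (Decidable)

open DecTotalOrder letterOrder using () renaming (trans to ≤ₗ-trans)
open DecMembership (≡-dec _≟_ _≟_) using (_∈?_)
open DecMembership _≟_ using () renaming (_∈?_ to _∈ℕ?_)
open InsertionSort letterOrder using (sort; insert)

-- Counting in lists of natural numbers

-- Why a multiset: the order of the strands and the sorted order of the columns need not agree, so
-- no fixed position in the product follows a given strand. Only the heights with multiplicity can
-- be compared with the valuations; a strand of valuation 0 is matched by a column `ε`. Cumulative
-- counts `#≤` record the multiset because raising or lowering a height is then an additive identity
-- in ℕ, free of subtraction. Why dominance: for an arbitrary admissible column the letters above
-- p_t need not form one run, and inserting D need not give back columns of the form 12⋯m.
-- `Dominant⁺` and `Dominant⁻` exclude this. C-trees satisfy them because each block of a reading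
-- starts at the current valuation of its strand.

𝟙≤ : ℕ → ℕ → ℕ
𝟙≤ zero    z       = 1
𝟙≤ (suc x) zero    = 0
-- Recursion instead of a decision: shifting letter and bound together is then a computation, on
-- which the shift identities below rely.
𝟙≤ (suc x) (suc z) = 𝟙≤ x z

#≤ : ℕ → List ℕ → ℕ
#≤ z []      = 0
#≤ z (x ∷ L) = 𝟙≤ x z + #≤ z L

infix 4 _≈_
_≈_ : List ℕ → List ℕ → Set
L ≈ M = ∀ z → #≤ z L ≡ #≤ z M

𝟙≤-yes : ∀ {x z} → x ≤ z → 𝟙≤ x z ≡ 1
𝟙≤-yes z≤n       = refl
𝟙≤-yes (s≤s x≤z) = 𝟙≤-yes x≤z

𝟙≤-no : ∀ {x z} → z < x → 𝟙≤ x z ≡ 0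
𝟙≤-no {suc x} {zero}  _         = refl
𝟙≤-no {suc x} {suc z} (s≤s z<x) = 𝟙≤-no z<x

𝟙≤-mono : ∀ x z → 𝟙≤ x z ≤ 𝟙≤ x (suc z)
𝟙≤-mono zero    z       = ≤-refl
𝟙≤-mono (suc x) zero    = z≤n
𝟙≤-mono (suc x) (suc z) = 𝟙≤-mono x z

𝟙≤-suc : ∀ x z → x ≢ suc z → 𝟙≤ x z ≡ 𝟙≤ x (suc z)
𝟙≤-suc zero          z       x≢ = refl
𝟙≤-suc (suc zero)    zero    x≢ = contradiction refl x≢
𝟙≤-suc (suc (suc x)) zero    x≢ = refl
𝟙≤-suc (suc x)       (suc z) x≢ = 𝟙≤-suc x z (x≢ ∘ cong suc)

#≤-++ : ∀ z L M → #≤ z (L ++ M) ≡ #≤ z L + #≤ z M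
#≤-++ z []      M = refl
#≤-++ z (x ∷ L) M = trans (cong (𝟙≤ x z +_) (#≤-++ z L M)) (sym (+-assoc (𝟙≤ x z) _ _))

#≤-mono : ∀ z L → #≤ z L ≤ #≤ (suc z) L
#≤-mono z []      = z≤n
#≤-mono z (x ∷ L) = +-mono-≤ (𝟙≤-mono x z) (#≤-mono z L)

#≤-monotone : ∀ {y z} L → y ≤ z → #≤ y L ≤ #≤ z L
#≤-monotone {y} L y≤z = go (≤⇒≤′ y≤z)
  where
  go : ∀ {z} → y ≤′ z → #≤ y L ≤ #≤ z L
  go ≤′-refl       = ≤-refl
  go (≤′-step y≤z) = ≤-trans (go y≤z) (#≤-mono _ L)

#≤-all : ∀ {z L} → All (_≤ z) L → #≤ z L ≡ length L
#≤-all []       = refl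
#≤-all (p ∷ ps) = cong₂ _+_ (𝟙≤-yes p) (#≤-all ps)

#≤-none : ∀ {z L} → All (z <_) L → #≤ z L ≡ 0
#≤-none []       = refl
#≤-none (p ∷ ps) = cong₂ _+_ (𝟙≤-no p) (#≤-none ps)

#≤-≤length : ∀ z L → #≤ z L ≤ length L
#≤-≤length z []      = z≤n
#≤-≤length z (x ∷ L) with x ≤? z
... | yes p rewrite 𝟙≤-yes p          = s≤s (#≤-≤length z L)
... | no ¬p rewrite 𝟙≤-no (≰⇒> ¬p) = m≤n⇒m≤1+n (#≤-≤length z L)

∈⇒#≤-positive : ∀ {z L} → z ∈ L → 0 < #≤ z L
∈⇒#≤-positive {z} (here refl) rewrite 𝟙≤-yes (≤-refl {z}) = s≤s z≤n
∈⇒#≤-positive {z} (there {x} p) = ≤-trans (∈⇒#≤-positive p) (m≤n+m _ (𝟙≤ x z))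

∈⇒#≤-jump : ∀ {z L} → suc z ∈ L → #≤ z L < #≤ (suc z) L
∈⇒#≤-jump {z} {_ ∷ L} (here refl)
  rewrite 𝟙≤-no (n<1+n z) | 𝟙≤-yes (≤-refl {suc z}) = s≤s (#≤-mono z L)
∈⇒#≤-jump {z} (there {x} p) = +-mono-≤-< (𝟙≤-mono x z) (∈⇒#≤-jump p)

#≤-positive⇒∈ : ∀ L → 0 < #≤ 0 L → 0 ∈ L
#≤-positive⇒∈ (zero  ∷ L) p = here refl
#≤-positive⇒∈ (suc x ∷ L) p = there (#≤-positive⇒∈ L p)

#≤-jump⇒∈ : ∀ z L → #≤ z L < #≤ (suc z) L → suc z ∈ L
#≤-jump⇒∈ z (x ∷ L) p with x ≟ suc z
... | yes refl = here refl
... | no x≢ rewrite 𝟙≤-suc x z x≢ = there (#≤-jump⇒∈ z L (+-cancelˡ-< (𝟙≤ x (suc z)) _ _ p))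

-- Membership is visible in the counts: as a jump between z and z + 1, or as positivity at 0.
∈-resp-≈ : ∀ {L M} → L ≈ M → ∀ {z} → z ∈ L → z ∈ M
∈-resp-≈ {L} {M} eq {zero}  p = #≤-positive⇒∈ M (subst (0 <_) (eq 0) (∈⇒#≤-positive p))
∈-resp-≈ {L} {M} eq {suc z} p =
  #≤-jump⇒∈ z M (subst₂ _<_ (eq z) (eq (suc z)) (∈⇒#≤-jump p))

Descending : List ℕ → Set
Descending = AllPairs _≥_

private
  maximum : ∀ {x L z} → All (x ≥_) L → z ∈ x ∷ L → z ≤ x
  maximum L≤x (here refl) = ≤-refl
  maximum L≤x (there p)   = All.lookup L≤x p

-- Each head is the maximum of the same multiset, so the heads agree and can be cancelled from the
-- counts.
≈⇒≡ : ∀ {L M} → Descending L → Descending M → L ≈ M → L ≡ M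
≈⇒≡ {[]}    {[]}    _        _        eq = refl
≈⇒≡ {[]}    {y ∷ M} _        _        eq = contradiction (∈-resp-≈ {y ∷ M} {[]} (sym ∘ eq) (here refl)) λ ()
≈⇒≡ {x ∷ L} {[]}    _        _        eq = contradiction (∈-resp-≈ {x ∷ L} {[]} eq (here refl)) λ ()
≈⇒≡ {x ∷ L} {y ∷ M} (a ∷ dL) (b ∷ dM) eq
  with refl ← ≤-antisym (maximum b (∈-resp-≈ {x ∷ L} {y ∷ M} eq (here refl)))
                        (maximum a (∈-resp-≈ {y ∷ M} {x ∷ L} (sym ∘ eq) (here refl)))
    = cong (x ∷_) (≈⇒≡ dL dM (λ z → +-cancelˡ-≡ (𝟙≤ x z) _ _ (eq z)))

-- Intervals of letters

up down : ℕ → ℕ → List ℕ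
up a zero      = []
up a (suc b)   = suc a ∷ up (suc a) b
down a zero    = []
down a (suc c) = a ∷ down (pred a) c

length-up : ∀ a b → length (up a b) ≡ b
length-up a zero    = refl
length-up a (suc b) = cong suc (length-up (suc a) b)

up-++ : ∀ a b c → up a b ++ up (a + b) c ≡ up a (b + c)
up-++ a zero    c = cong (λ a → up a c) (+-identityʳ a)
up-++ a (suc b) c = cong (suc a ∷_) (trans (cong (λ d → up (suc a) b ++ up d c) (+-suc a b)) (up-++ (suc a) b c))

up-split : ∀ b m → suc b ≤ m → up 0 m ≡ up 0 b ++ suc b ∷ up (suc b) (m ∸ suc b)
up-split b m b<m = trans (cong (up 0) (sym eq)) (sym (up-++ 0 b (suc (m ∸ suc b))))
  where
  eq : b + suc (m ∸ suc b) ≡ m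
  eq = trans (+-suc b _) (m+[n∸m]≡n b<m)

∈-up⁻ : ∀ {a b z} → z ∈ up a b → a < z × z ≤ a + b
∈-up⁻ {a} {suc b} (here refl) = ≤-refl , ≤-trans (s≤s (m≤m+n a b)) (≤-reflexive (sym (+-suc a b)))
∈-up⁻ {a} {suc b} (there p)   with a<z , z≤ ← ∈-up⁻ p = <⇒≤ a<z , ≤-trans z≤ (≤-reflexive (sym (+-suc a b)))

∈-up⁺ : ∀ {a b z} → a < z → z ≤ a + b → z ∈ up a b
∈-up⁺ {a} {zero}  a<z z≤ = contradiction (≤-trans a<z (≤-trans z≤ (≤-reflexive (+-identityʳ a)))) 1+n≰n
∈-up⁺ {a} {suc b} {z} a<z z≤ with z ≟ suc a
... | yes refl = here refl
... | no z≢    = there (∈-up⁺ (≤∧≢⇒< a<z (z≢ ∘ sym)) (≤-trans z≤ (≤-reflexive (+-suc a b))))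

up-> : ∀ a b → All (a <_) (up a b)
up-> a b = All.tabulate (proj₁ ∘ ∈-up⁻)

up-≤ : ∀ a b → All (_≤ a + b) (up a b)
up-≤ a b = All.tabulate (proj₂ ∘ ∈-up⁻)

Increasing : List ℕ → Set
Increasing = AllPairs _<_

up-increasing : ∀ a b → Increasing (up a b)
up-increasing a zero    = []
up-increasing a (suc b) = up-> (suc a) b ∷ up-increasing (suc a) b

#≤-up : ∀ z m → z ≤ m → #≤ z (up 0 m) ≡ z
#≤-up z m z≤m = begin
  #≤ z (up 0 m)                          ≡⟨ cong (λ m → #≤ z (up 0 m)) (sym (m+[n∸m]≡n z≤m)) ⟩
  #≤ z (up 0 (z + (m ∸ z)))              ≡⟨ cong (#≤ z) (sym (up-++ 0 z (m ∸ z))) ⟩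
  #≤ z (up 0 z ++ up z (m ∸ z))          ≡⟨ #≤-++ z (up 0 z) _ ⟩
  #≤ z (up 0 z) + #≤ z (up z (m ∸ z))    ≡⟨ cong₂ _+_ (trans (#≤-all (up-≤ 0 z)) (length-up 0 z)) (#≤-none (up-> z (m ∸ z))) ⟩
  z + 0                                  ≡⟨ +-identityʳ z ⟩
  z                                      ∎
  where open ≡-Reasoning

-- Appending the block [a+1, a+b] turns one column height a into a+b.
#≤-up-shift : ∀ a b i → 𝟙≤ (a + b) i + #≤ (suc i) (up a b) ≡ 𝟙≤ a i + #≤ i (up a b)
#≤-up-shift a zero    i = cong (λ a → 𝟙≤ a i + 0) (+-identityʳ a)
#≤-up-shift a (suc b) i = begin
  𝟙≤ (a + suc b) i + (𝟙≤ a i + U′)     ≡⟨ cong (λ c → 𝟙≤ c i + (𝟙≤ a i + U′)) (+-suc a b) ⟩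
  𝟙≤ (suc a + b) i + (𝟙≤ a i + U′)     ≡⟨ x∙yz≈y∙xz (𝟙≤ (suc a + b) i) (𝟙≤ a i) U′ ⟩
  𝟙≤ a i + (𝟙≤ (suc a + b) i + U′)     ≡⟨ cong (𝟙≤ a i +_) (#≤-up-shift (suc a) b i) ⟩
  𝟙≤ a i + (𝟙≤ (suc a) i + #≤ i (up (suc a) b)) ∎
  where
  open ≡-Reasoning
  U′ = #≤ (suc i) (up (suc a) b)

-- The bar of j turns a height j into j - 1, so the block of bars a, a - 1, ... takes a height a
-- down to a ∸ c. The hypothesis c ≤ a keeps `pred` exact along the recursion.
#≤-down-shift : ∀ a c i → c ≤ a → 𝟙≤ (a ∸ c) i + #≤ i (down a c) ≡ 𝟙≤ a i + #≤ (suc i) (down a c)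
#≤-down-shift a       zero    i c≤a       = refl
#≤-down-shift (suc a) (suc c) i (s≤s c≤a) = begin
  𝟙≤ (a ∸ c) i + (𝟙≤ (suc a) i + D)        ≡⟨ x∙yz≈y∙xz (𝟙≤ (a ∸ c) i) (𝟙≤ (suc a) i) D ⟩
  𝟙≤ (suc a) i + (𝟙≤ (a ∸ c) i + D)        ≡⟨ cong (𝟙≤ (suc a) i +_) (#≤-down-shift a c i c≤a) ⟩
  𝟙≤ (suc a) i + (𝟙≤ a i + #≤ (suc i) (down a c)) ∎
  where
  open ≡-Reasoning
  D = #≤ i (down a c)

-- Distinct letters in an interval (a, z]. With a = 0 this makes every nonempty unbarred column
-- admissible.
#≤-increasing : ∀ {a L} z → Increasing L → All (a <_) L → #≤ z L ≤ z ∸ a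
#≤-increasing z [] _ = z≤n
#≤-increasing {a} z (_∷_ {x} {L} x<L iL) (a<x ∷ a<L) with x ≤? z
... | yes x≤z rewrite 𝟙≤-yes x≤z = begin
  suc (#≤ z L)   ≤⟨ s≤s (#≤-increasing z iL x<L) ⟩
  suc (z ∸ x)    ≡⟨ +-∸-assoc 1 x≤z ⟨
  suc z ∸ x      ≤⟨ ∸-monoʳ-≤ (suc z) a<x ⟩
  z ∸ a          ∎
  where open ≤-Reasoning
... | no x≰z rewrite 𝟙≤-no (≰⇒> x≰z) = ≤-trans (#≤-increasing z iL x<L) (∸-monoʳ-≤ z (<⇒≤ a<x))

-- carve m B C lists [1, m] without B, followed by C; here B decreases.
carve : ℕ → List ℕ → List ℕ → List ℕ
carve m []      C = up 0 m ++ C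
carve m (b ∷ B) C = carve (pred b) B (up b (m ∸ b) ++ C)

Decreasing : List ℕ → Set
Decreasing = AllPairs _>_

Letters : ℕ → List ℕ → Set
Letters m = All (λ b → 1 ≤ b × b ≤ m)

below-head : ∀ {m b B} → All (b >_) B → Letters m (b ∷ B) → Letters (pred b) B
below-head {b = suc b} b>B (_ ∷ rB) = All.zipWith (λ { (s≤s x≤b , 1≤x , _) → 1≤x , x≤b }) (b>B , rB)

-- As multisets, `carve m B C` together with B is [1, m] together with C; the additive form again
-- avoids subtraction.
#≤-carve : ∀ {m B} C z → Decreasing B → Letters m B →
           #≤ z (carve m B C) + #≤ z B ≡ #≤ z (up 0 m) + #≤ z C
#≤-carve {m} {[]}        C z _ _ = trans (+-identityʳ _) (#≤-++ z (up 0 m) C)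
#≤-carve {m} {suc b ∷ B} C z (b>B ∷ dB) r@((_ , b≤m) ∷ _) = begin
  #≤ z D + (𝟙≤ (suc b) z + #≤ z B)                          ≡⟨ x∙yz≈y∙xz (#≤ z D) (𝟙≤ (suc b) z) _ ⟩
  𝟙≤ (suc b) z + (#≤ z D + #≤ z B)                          ≡⟨ cong (𝟙≤ (suc b) z +_) (#≤-carve (V ++ C) z dB (below-head b>B r)) ⟩
  𝟙≤ (suc b) z + (#≤ z (up 0 b) + #≤ z (V ++ C))            ≡⟨ cong (λ x → 𝟙≤ (suc b) z + (#≤ z (up 0 b) + x)) (#≤-++ z V C) ⟩
  𝟙≤ (suc b) z + (#≤ z (up 0 b) + (#≤ z V + #≤ z C))        ≡⟨ rearrange (𝟙≤ (suc b) z) (#≤ z (up 0 b)) (#≤ z V) (#≤ z C) ⟩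
  #≤ z (up 0 b) + (𝟙≤ (suc b) z + #≤ z V) + #≤ z C          ≡⟨ cong (_+ #≤ z C) (#≤-++ z (up 0 b) (suc b ∷ V)) ⟨
  #≤ z (up 0 b ++ suc b ∷ V) + #≤ z C                       ≡⟨ cong (λ U → #≤ z U + #≤ z C) (up-split b m b≤m) ⟨
  #≤ z (up 0 m) + #≤ z C                                    ∎
  where
  open ≡-Reasoning
  V = up (suc b) (m ∸ suc b)
  D = carve b B (V ++ C)
  rearrange : ∀ w x y z → w + (x + (y + z)) ≡ x + (w + y) + z
  rearrange = solve-∀

up-++-increasing : ∀ {a b C} → Increasing C → All (a + b <_) C → Increasing (up a b ++ C)
up-++-increasing {a} {b} iC m<C =
  AllPairs.++⁺ (up-increasing a b) iC (All.map (λ x≤m → All.map (≤-<-trans x≤m) m<C) (up-≤ a b))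

carve-increasing : ∀ {m B C} → Decreasing B → Letters m B → Increasing C → All (m <_) C → Increasing (carve m B C)
carve-increasing [] [] iC m<C = up-++-increasing iC m<C
carve-increasing {m} {suc b ∷ B} {C} (b>B ∷ dB) r@((_ , b≤m) ∷ _) iC m<C =
  carve-increasing dB (below-head b>B r)
    (up-++-increasing iC (subst (λ m → All (m <_) C) (sym (m+[n∸m]≡n b≤m)) m<C))
    (All.++⁺ (All.map (<-trans (n<1+n b)) (up-> (suc b) _)) (All.map (<-trans b≤m) m<C))

∈-carve⁻ : ∀ {m B C z} → Decreasing B → Letters m B →
           z ∈ carve m B C → (1 ≤ z × z ≤ m × z ∉ B) ⊎ z ∈ C
∈-carve⁻ {m} [] [] p with ∈-++⁻ (up 0 m) p
... | inj₁ q with 1≤z , z≤m ← ∈-up⁻ q = inj₁ (1≤z , z≤m , λ ())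
... | inj₂ q = inj₂ q
∈-carve⁻ {m} {suc b ∷ B} (b>B ∷ dB) r@((_ , b≤m) ∷ _) p with ∈-carve⁻ dB (below-head b>B r) p
... | inj₁ (1≤z , z≤b , z∉B) = inj₁ (1≤z , ≤-trans z≤b (<⇒≤ b≤m) ,
        λ { (here refl) → 1+n≰n z≤b ; (there z∈B) → z∉B z∈B })
... | inj₂ q with ∈-++⁻ (up (suc b) (m ∸ suc b)) q
...   | inj₂ z∈C = inj₂ z∈C
...   | inj₁ z∈V with b<z , z≤ ← ∈-up⁻ z∈V =
        inj₁ (≤-trans (s≤s z≤n) b<z , ≤-trans z≤ (≤-reflexive (m+[n∸m]≡n b≤m)) ,
          λ { (here refl) → 1+n≰n b<z ; (there z∈B) → 1+n≰n (<-trans b<z (All.lookup b>B z∈B)) })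

∈-carve⁺ʳ : ∀ {m} B {C z} → z ∈ C → z ∈ carve m B C
∈-carve⁺ʳ {m} []      p = ∈-++⁺ʳ (up 0 m) p
∈-carve⁺ʳ {m} (b ∷ B) p = ∈-carve⁺ʳ B (∈-++⁺ʳ (up b (m ∸ b)) p)

∈-carve⁺ : ∀ {m B C z} → Decreasing B → Letters m B → 1 ≤ z → z ≤ m → z ∉ B → z ∈ carve m B C
∈-carve⁺ {B = []}        _          r 1≤z z≤m z∉B = ∈-++⁺ˡ (∈-up⁺ 1≤z z≤m)
∈-carve⁺ {m} {suc b ∷ B} {C} {z} (b>B ∷ dB) r@((_ , b≤m) ∷ _) 1≤z z≤m z∉B with z ≤? b
... | no z≰b  = ∈-carve⁺ʳ B (∈-++⁺ˡ (∈-up⁺ (≤∧≢⇒< (≰⇒> z≰b) (λ { refl → z∉B (here refl) }))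
                  (≤-trans z≤m (≤-reflexive (sym (m+[n∸m]≡n b≤m))))))
... | yes z≤b = ∈-carve⁺ dB (below-head b>B r) 1≤z z≤b (z∉B ∘ there)

carve-letters : ∀ {m B n} → Decreasing B → Letters m B → m ≤ n → Letters n (carve m B [])
carve-letters {m} {B} {n} dB rB m≤n = All.tabulate bounds
  where
  bounds : ∀ {z} → z ∈ carve m B [] → 1 ≤ z × z ≤ n
  bounds p with ∈-carve⁻ dB rB p
  ... | inj₁ (1≤z , z≤m , _) = 1≤z , ≤-trans z≤m m≤n

-- Columns

𝔠⁺≡up : ∀ a b → 𝔠⁺ a b ≡ map pos (up a b)
𝔠⁺≡up a zero    = refl
𝔠⁺≡up a (suc b) = cong (pos (suc a) ∷_) (𝔠⁺≡up (suc a) b)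

N-++ : ∀ z u v → N z (u ++ v) ≡ N z u + N z v
N-++ z u v = trans (cong length (filter-++ (within? z) u v)) (length-++ (filter (within? z) u))

N-pos : ∀ z X → N z (map pos X) ≡ #≤ z X
N-pos z []      = refl
N-pos z (x ∷ X) with x ≤? z
... | yes x≤z rewrite 𝟙≤-yes x≤z =
  trans (cong length (filter-accept (within? z) {pos x} {map pos X} (inj₁ (₁∼₁ x≤z)))) (cong suc (N-pos z X))
... | no x≰z rewrite 𝟙≤-no (≰⇒> x≰z) =
  trans (cong length (filter-reject (within? z) {pos x} {map pos X} λ { (inj₁ (₁∼₁ x≤z)) → x≰z x≤z })) (N-pos z X)

N-bar : ∀ z B → N z (map bar B) ≡ #≤ z B
N-bar z []      = refl
N-bar z (b ∷ B) with b ≤? z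
... | yes b≤z rewrite 𝟙≤-yes b≤z =
  trans (cong length (filter-accept (within? z) {bar b} {map bar B} (inj₂ (₂∼₂ b≤z)))) (cong suc (N-bar z B))
... | no b≰z rewrite 𝟙≤-no (≰⇒> b≰z) =
  trans (cong length (filter-reject (within? z) {bar b} {map bar B} λ { (inj₂ (₂∼₂ b≤z)) → b≰z b≤z })) (N-bar z B)

N-pos-bar : ∀ z X B → N z (map pos X ++ map bar B) ≡ #≤ z X + #≤ z B
N-pos-bar z X B = trans (N-++ z (map pos X) (map bar B)) (cong₂ _+_ (N-pos z X) (N-bar z B))

-- The unbarred letters X and the bars of B of one column, in a form that also covers the empty
-- word. The bound includes z = 0, where it holds because 0 is not a letter.
record IsColumnPair (n : ℕ) (X B : List ℕ) : Set where
  field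
    increasing : Increasing X
    decreasing : Decreasing B
    lettersX   : Letters n X
    lettersB   : Letters n B
    bounded    : ∀ z → z ≤ n → #≤ z X + #≤ z B ≤ z

<ₗ-trans : ∀ {x y z} → x <ₗ y → y <ₗ z → x <ₗ z
<ₗ-trans = ⊎-<-transitive <-trans (λ x>y y>z → <-trans y>z x>y)

AllPairs-++⁻ : ∀ {a ℓ} {A : Set a} {R : Rel A ℓ} xs {ys} →
               AllPairs R (xs ++ ys) → AllPairs R xs × AllPairs R ys
AllPairs-++⁻ []       ps       = [] , ps
AllPairs-++⁻ (x ∷ xs) (p ∷ ps) with pxs , pys ← AllPairs-++⁻ xs ps = All.++⁻ˡ xs p ∷ pxs , pys

private
  all-pairs : ∀ {u} → Linked _<ₗ_ u → AllPairs _<ₗ_ u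
  all-pairs = Linked.Linked⇒AllPairs <ₗ-trans

#≤0 : ∀ {n X} → Letters n X → #≤ 0 X ≡ 0
#≤0 = #≤-none ∘ All.map proj₁

toPair : ∀ {n} X B → (map pos X ++ map bar B ≡ [] ⊎ IsAdmissible n (map pos X ++ map bar B)) → IsColumnPair n X B
toPair []      []      (inj₁ _) = record
  { increasing = [] ; decreasing = [] ; lettersX = [] ; lettersB = [] ; bounded = λ _ _ → z≤n }
toPair {n} X   B       (inj₂ (mkAdmissible _ (alphabet , linked) bound)) = record
  { increasing = AllPairs.map (λ { (₁∼₁ p) → p }) (AllPairs.map⁻ (proj₁ pairs))
  ; decreasing = AllPairs.map (λ { (₂∼₂ p) → p }) (AllPairs.map⁻ (proj₂ pairs))
  ; lettersX   = lX
  ; lettersB   = lB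
  ; bounded    = λ
    { zero      _ → ≤-reflexive (cong₂ _+_ (#≤0 lX) (#≤0 lB))
    ; z@(suc _) p → subst (_≤ z) (N-pos-bar z X B) (bound z (s≤s z≤n) p) }
  }
  where
  pairs = AllPairs-++⁻ (map pos X) (all-pairs linked)
  lX = All.map⁻ (All.++⁻ˡ (map pos X) alphabet)
  lB = All.map⁻ (All.++⁻ʳ (map pos X) alphabet)

IsPositive : ℕ → List ℕ → Set
IsPositive n X = Increasing X × Letters n X

isColumn-pos : ∀ {n X} → IsPositive n X → IsColumn n (map pos X)
isColumn-pos (iX , lX) =
  All.map⁺ lX , Linked.AllPairs⇒Linked (AllPairs.map⁺ {f = inj₁} (AllPairs.map ₁∼₁ iX))

isAdmissible-pos : ∀ {n X} → IsPositive n X → map pos X ≢ [] → IsAdmissible n (map pos X)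
isAdmissible-pos {X = X} pX@(iX , lX) ≢[] = mkAdmissible ≢[] (isColumn-pos {X = X} pX)
  (λ z _ _ → subst (_≤ z) (sym (N-pos z X)) (#≤-increasing z iX (All.map proj₁ lX)))

isAdmissible-pos′ : ∀ {n X} → IsPositive n X → _≡_ {A = Word} (map pos X) [] ⊎ IsAdmissible n (map pos X)
isAdmissible-pos′ {X = []}    pX = inj₁ refl
isAdmissible-pos′ {X = _ ∷ _} pX = inj₂ (isAdmissible-pos pX λ ())

⟨_,_⟩ : ∀ {n} X → .(IsPositive n X) → ACol n
⟨ X , pX ⟩ = toACol (map pos X) (isAdmissible-pos′ {X = X} pX)

letters-toACol : ∀ {n} u .(p : u ≡ [] ⊎ IsAdmissible n u) → letters (toACol u p) ≡ u
letters-toACol []      p = refl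
letters-toACol (_ ∷ _) p = refl

toACol-cong : ∀ {n u v} .{p : u ≡ [] ⊎ IsAdmissible n u} .{q : v ≡ [] ⊎ IsAdmissible n v} →
              u ≡ v → toACol u p ≡ toACol v q
toACol-cong refl = refl

up-positive : ∀ {n m} → m ≤ n → IsPositive n (up 0 m)
up-positive {m = m} m≤n =
  up-increasing 0 m , All.tabulate (λ p → proj₁ (∈-up⁻ p) , ≤-trans (proj₂ (∈-up⁻ p)) m≤n)

𝔠≡ : ∀ {n} m .(m≤n : m ≤ n) → 𝔠 m m≤n ≡ ⟨ up 0 m , up-positive m≤n ⟩
𝔠≡ m m≤n = toACol-cong (𝔠⁺≡up 0 m)

-- The order on positive columns

private
  insert-head : ∀ {x X} → All (x <_) X → insert (pos x) (map pos X) ≡ pos x ∷ map pos X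
  insert-head []            = refl
  insert-head {x} (_∷_ {y} x<y _) rewrite dec-true (pos x ≤ₗ? pos y) (₁∼₁ (<⇒≤ x<y)) = refl

  sort-pos : ∀ {X} → Increasing X → sort (map pos X) ≡ map pos X
  sort-pos []       = refl
  sort-pos (x<X ∷ iX) = trans (cong (insert _) (sort-pos iX)) (insert-head x<X)

  doubled-pos : ∀ n X → doubled n (map pos X) ≡ []
  doubled-pos n X = filter-none (λ z → (pos z ∈? map pos X) ×-dec (bar z ∈? map pos X))
    (All.tabulate λ { _ (_ , p) → case ∈-map⁻ pos p of λ () })

  replace-[] : ∀ {X} → Increasing X → replace [] [] (map pos X) ≡ map pos X
  replace-[] {X} iX = begin
    sort (filter P? (map pos X) ++ [])  ≡⟨ cong sort (++-identityʳ (filter P? (map pos X))) ⟩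
    sort (filter P? (map pos X))        ≡⟨ cong sort (filter-all P? {map pos X} (All.tabulate λ _ ())) ⟩
    sort (map pos X)                    ≡⟨ sort-pos iX ⟩
    map pos X                           ∎
    where
    open ≡-Reasoning
    P? = λ (x : Letter) → ¬? (x ∈? [])

-- No letter of an unbarred column is doubled, so the column is its own split form, and on such
-- columns `_⪯_` only compares rows.
rightSplit-pos : ∀ {n X} → Increasing X → rightSplit n (map pos X) ≡ map pos X
rightSplit-pos {n} {X} iX rewrite doubled-pos n X = replace-[] iX

leftSplit-pos : ∀ {n X} → Increasing X → leftSplit n (map pos X) ≡ map pos X
leftSplit-pos {n} {X} iX rewrite doubled-pos n X = replace-[] iX

-- If the first letter d of D exceeded the first letter x of X, then D would have no letter up to x
-- while X has one. Once d ≤ x, the two heads cancel from every count with z ≥ x, and below x the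
-- tail of X has no letters.
prefix-pos : ∀ {D X} → Increasing D → Increasing X → (∀ z → #≤ z X ≤ #≤ z D) →
             Prefix (flip _≤ₗ_) (map pos X) (map pos D)
prefix-pos {D}     {[]}    iD iX X≤D = []
prefix-pos {[]}    {x ∷ X} iD iX X≤D =
  contradiction (≤-trans (∈⇒#≤-positive (here {xs = X} (refl {x = x}))) (X≤D x)) λ ()
prefix-pos {d ∷ D} {x ∷ X} (d<D ∷ iD) (x<X ∷ iX) X≤D = ₁∼₁ d≤x ∷ prefix-pos iD iX tails
  where
  d≤x : d ≤ x
  d≤x with d ≤? x
  ... | yes p = p
  ... | no ¬p = contradiction (≤-trans (∈⇒#≤-positive (here {xs = X} refl)) (≤-trans (X≤D x)
    (≤-reflexive (#≤-none {x} (≰⇒> ¬p ∷ All.map (<-trans (≰⇒> ¬p)) d<D))))) λ ()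
  tails : ∀ z → #≤ z X ≤ #≤ z D
  tails z with x ≤? z
  ... | no x≰z = ≤-trans (≤-reflexive (#≤-none (All.map (<-trans (≰⇒> x≰z)) x<X))) z≤n
  ... | yes x≤z with p ← X≤D z rewrite 𝟙≤-yes x≤z | 𝟙≤-yes (≤-trans d≤x x≤z) = ≤-pred p

⪯-pos : ∀ {n D X} .(pD : IsPositive n D) .(pX : IsPositive n X) → Increasing D → Increasing X →
        (∀ z → #≤ z X ≤ #≤ z D) → ⟨ D , pD ⟩ ⪯ ⟨ X , pX ⟩
⪯-pos {X = []} pD pX iD iX X≤D = _
⪯-pos {D = []} {X = x ∷ X} pD pX iD iX X≤D with () ← prefix-pos iD iX X≤D
⪯-pos {n} {d ∷ D} {X = x ∷ X} pD pX iD iX X≤D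
  rewrite rightSplit-pos {n} iD | leftSplit-pos {n} iX = prefix-pos iD iX X≤D

-- Plactic congruences

plactic-++ˡ : ∀ {n u v} p → Plactic n u v → Plactic n (p ++ u) (p ++ v)
plactic-++ˡ []      r = r
plactic-++ˡ {n} (x ∷ p) r =
  EqClosure.gmap (x ∷_) (λ { (step p s r) → step (x ∷ p) s r }) (plactic-++ˡ {n = n} p r)

plactic-++ʳ : ∀ {n u v} t → Plactic n u v → Plactic n (u ++ t) (v ++ t)
plactic-++ʳ {n} t = EqClosure.gmap (_++ t) λ { (step p s {u} {v} r) →
  subst₂ (PlacticStep n) (assoc p u s) (assoc p v s) (step p (s ++ t) r) }
  where
  assoc : ∀ p u s → p ++ u ++ s ++ t ≡ (p ++ u ++ s) ++ t
  assoc p u s = sym (trans (++-assoc p (u ++ s) t) (cong (p ++_) (++-assoc u s t)))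

≡⇒plactic : ∀ {n u v} → u ≡ v → Plactic n u v
≡⇒plactic refl = Star.ε

relation : ∀ {n u v} → PlacticRelation n u v → ∀ s → Plactic n (u ++ s) (v ++ s)
relation r s = EqClosure.return (step [] s r)

module _ {n x : ℕ} (lx : InAlphabet n (pos x)) where

  private
    retract : ∀ {y Y} → x ≤ y → Increasing (y ∷ Y) → Letters n (y ∷ Y) →
              Plactic n (pos y ∷ map pos Y ++ pos x ∷ []) (pos y ∷ pos x ∷ map pos Y)
    retract {Y = []}    x≤y _ _ = Star.ε
    retract {y} {z ∷ Y} x≤y ((y<z ∷ _) ∷ iY) (ly ∷ lz ∷ lY) =
      plactic-++ˡ {n = n} (pos y ∷ []) (retract (≤-trans x≤y (<⇒≤ y<z)) iY (lz ∷ lY)) ◅◅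
      relation (R₁ (lx ∷ ly ∷ lz ∷ []) (₁∼₁ x≤y) (₁∼₁ y<z) λ ()) (map pos Y)

    -- The relation R₁′ moves x left past v only in front of a further letter; y provides that
    -- letter for the last v of V.
    advance : ∀ V {y s} → Increasing V → All (_< y) V → y ≤ x → Letters n V → InAlphabet n (pos y) →
              Plactic n (map pos V ++ pos x ∷ pos y ∷ s) (pos x ∷ map pos V ++ pos y ∷ s)
    advance []           iV V<y y≤x lV ly = Star.ε
    advance (v ∷ [])     iV (v<y ∷ _) y≤x (lv ∷ _) ly =
      relation (R₁′ (lv ∷ ly ∷ lx ∷ []) (₁∼₁ v<y) (₁∼₁ y≤x) λ ()) _
    advance (v ∷ w ∷ V) ((v<w ∷ _) ∷ iV) (_ ∷ V<y@(w<y ∷ _)) y≤x (lv ∷ lV@(lw ∷ _)) ly =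
      plactic-++ˡ {n = n} (pos v ∷ []) (advance (w ∷ V) iV V<y y≤x lV ly) ◅◅
      relation (R₁′ (lv ∷ lw ∷ lx ∷ []) (₁∼₁ v<w) (₁∼₁ (≤-trans (<⇒≤ w<y) y≤x)) λ ()) _

  -- Write 12⋯p as V x Y. The new x first moves left past the larger letters Y by R₁ and stops
  -- behind the x already there; the pair x x then lets one copy pass the smaller letters V by R₁′.
  up-commutes : ∀ {p} → x ≤ p → p ≤ n →
                Plactic n (map pos (up 0 p) ++ pos x ∷ []) (pos x ∷ map pos (up 0 p))
  up-commutes {p} x≤p p≤n = helper (proj₁ lx) x≤p
    where
    helper : 1 ≤ x → x ≤ p → Plactic n (map pos (up 0 p) ++ pos x ∷ []) (pos x ∷ map pos (up 0 p))
    helper (s≤s {n = b} _) b<p = subst (λ U → Plactic n (map pos U ++ pos x ∷ []) (pos x ∷ map pos U))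
      (sym (up-split b p b<p))
      (≡⇒plactic {n = n} (trans (cong (_++ pos x ∷ []) (map-++ pos V (x ∷ Y))) (++-assoc (map pos V) (pos x ∷ map pos Y) _)) ◅◅
       plactic-++ˡ {n = n} (map pos V) (retract ≤-refl iY lY) ◅◅
       advance V (up-increasing 0 b) (All.map s≤s (up-≤ 0 b)) ≤-refl (proj₂ (up-positive (≤-trans (n≤1+n b) (≤-trans b<p p≤n)))) lx ◅◅
       ≡⇒plactic {n = n} (cong (pos x ∷_) (sym (map-++ pos V (x ∷ Y)))))
      where
      V = up 0 b
      Y = up (suc b) (p ∸ suc b)
      iY : Increasing (suc b ∷ Y)
      iY = up-increasing b (suc (p ∸ suc b))
      lY : Letters n (suc b ∷ Y)
      lY = All.++⁻ʳ V (subst (Letters n) (up-split b p b<p) (proj₂ (up-positive p≤n)))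

up-commutes* : ∀ {n p X} → p ≤ n → Letters p X →
               Plactic n (map pos (up 0 p) ++ map pos X) (map pos X ++ map pos (up 0 p))
up-commutes* {n} {p} {[]}    p≤n []                = ≡⇒plactic {n = n} (++-identityʳ (map pos (up 0 p)))
up-commutes* {n} {p} {x ∷ X} p≤n ((1≤x , x≤p) ∷ lX) =
  ≡⇒plactic {n = n} (sym (++-assoc (map pos (up 0 p)) (pos x ∷ []) (map pos X))) ◅◅
  plactic-++ʳ {n = n} (map pos X) (up-commutes (1≤x , ≤-trans x≤p p≤n) x≤p p≤n) ◅◅
  plactic-++ˡ {n = n} (pos x ∷ []) (up-commutes* p≤n lX)

-- Contraction of a bar against its letter

module _ {n b : ℕ} {C : List ℕ} (b<n : suc b ≤ n)
         (iC : Increasing C) (b<C : All (suc b <_) C) (lC : Letters n C) where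

  private
    U = up 0 b
    X = U ++ suc b ∷ C
    W = map pos X ++ bar (suc b) ∷ []

    iX : Increasing X
    iX = up-++-increasing (b<C ∷ iC) (n<1+n b ∷ All.map (<-trans (n<1+n b)) b<C)

    lX : Letters n X
    lX = All.++⁺ (proj₂ (up-positive (≤-trans (n≤1+n b) b<n))) ((s≤s z≤n , b<n) ∷ lC)

    column-W : IsColumn n W
    column-W = All.++⁺ (All.map⁺ lX) ((s≤s z≤n , b<n) ∷ []) ,
      Linked.AllPairs⇒Linked (AllPairs.++⁺ (AllPairs.map⁺ {f = inj₁} (AllPairs.map ₁∼₁ iX)) ([] ∷ [])
        (All.map⁺ (All.tabulate λ _ → ₁∼₂ ∷ [])))

    N-W : ∀ z → N z W ≡ #≤ z X + #≤ z (suc b ∷ [])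
    N-W z = N-pos-bar z X (suc b ∷ [])

    N-b : N (suc b) W ≡ suc (suc b)
    N-b = begin
      N (suc b) W                                             ≡⟨ N-W (suc b) ⟩
      #≤ (suc b) X + (𝟙≤ b b + 0)                             ≡⟨ cong₂ _+_ (#≤-++ (suc b) U (suc b ∷ C)) (cong (_+ 0) (𝟙≤-yes (≤-refl {b}))) ⟩
      #≤ (suc b) U + (𝟙≤ b b + #≤ (suc b) C) + 1              ≡⟨ cong (_+ 1) (cong₂ _+_ #U (cong₂ _+_ (𝟙≤-yes (≤-refl {b})) (#≤-none b<C))) ⟩
      b + 1 + 1                                               ≡⟨ trans (+-comm (b + 1) 1) (cong suc (+-comm b 1)) ⟩
      suc (suc b)                                             ∎
      where
      open ≡-Reasoning
      #U : #≤ (suc b) U ≡ b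
      #U = trans (#≤-all (All.map m≤n⇒m≤1+n (up-≤ 0 b))) (length-up 0 b)

    head-one : ∀ b {t : Word} → ∃[ v ] map pos (up 0 b ++ suc b ∷ C) ++ t ≡ pos 1 ∷ v
    head-one zero    = _ , refl
    head-one (suc _) = _ , refl

    N-pos-∷ : ∀ z x u → N z (pos x ∷ u) ≡ 𝟙≤ x z + N z u
    N-pos-∷ z x u = trans (N-++ z (pos x ∷ []) u) (cong (_+ N z u) (trans (N-pos z (x ∷ [])) (+-identityʳ (𝟙≤ x z))))

    N-factor : ∀ z p f s → N z f ≤ N z (p ++ f ++ s)
    N-factor z p f s = begin
      N z f                        ≤⟨ m≤m+n (N z f) (N z s) ⟩
      N z f + N z s                ≤⟨ m≤n+m _ (N z p) ⟩
      N z p + (N z f + N z s)      ≡⟨ cong (N z p +_) (N-++ z f s) ⟨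
      N z p + N z (f ++ s)         ≡⟨ N-++ z p (f ++ s) ⟨
      N z (p ++ f ++ s)            ∎
      where open ≤-Reasoning

    #≤X : ∀ z → #≤ z X ≤ z
    #≤X z = #≤-increasing z iX (All.map proj₁ lX)

    -- A proper factor misses the letter 1 or the last letter.
    factor-bound : ∀ z p f s → 1 ≤ z → W ≡ p ++ f ++ s → f ≢ W → N z f ≤ z
    factor-bound z (x ∷ p) f s 1≤z eq f≢W with v , W≡ ← head-one b = begin
      N z f                        ≤⟨ N-factor z p f s ⟩
      N z (p ++ f ++ s)            ≡⟨ cong (N z) (∷-injectiveʳ (trans (sym W≡) eq)) ⟨
      N z v                        ≤⟨ ≤-pred suc-N ⟩
      z                            ∎
      where
      open ≤-Reasoning
      suc-N : suc (N z v) ≤ suc z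
      suc-N = begin
        suc (N z v)                  ≡⟨ cong (_+ N z v) (𝟙≤-yes 1≤z) ⟨
        𝟙≤ 1 z + N z v               ≡⟨ N-pos-∷ z 1 v ⟨
        N z (pos 1 ∷ v)              ≡⟨ cong (N z) W≡ ⟨
        N z W                        ≡⟨ N-W z ⟩
        #≤ z X + #≤ z (suc b ∷ [])   ≤⟨ +-mono-≤ (#≤X z) (#≤-≤length z (suc b ∷ [])) ⟩
        z + 1                        ≡⟨ +-comm z 1 ⟩
        suc z                        ∎
    factor-bound z [] f s 1≤z eq f≢W with initLast s
    ... | []      = contradiction (sym (trans eq (++-identityʳ f))) f≢W
    ... | s′ ∷ʳ′ y = begin
      N z f                        ≤⟨ N-factor z [] f s′ ⟩
      N z (f ++ s′)                ≡⟨ cong (N z) (∷ʳ-injectiveˡ (map pos X) (f ++ s′) (trans eq (sym (++-assoc f s′ (y ∷ []))))) ⟨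
      N z (map pos X)              ≡⟨ N-pos z X ⟩
      #≤ z X                       ≤⟨ #≤X z ⟩
      z                            ∎
      where open ≤-Reasoning

    proper-factors : ∀ p f s → W ≡ p ++ f ++ s → f ≢ [] → f ≢ W → IsAdmissible n f
    proper-factors p f s eq f≢[] f≢W = mkAdmissible f≢[] (lf , Linked.AllPairs⇒Linked iF)
      (λ z 1≤z _ → factor-bound z p f s 1≤z eq f≢W)
      where
      lf = All.++⁻ˡ f (All.++⁻ʳ p (subst (All (InAlphabet n)) eq (proj₁ column-W)))
      iF = proj₁ (AllPairs-++⁻ f (proj₂ (AllPairs-++⁻ p (subst (AllPairs _<ₗ_) eq
             (Linked.Linked⇒AllPairs <ₗ-trans (proj₂ column-W))))))

    -- The only bar in W is that of b + 1, so there is no smaller pair to contract.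
    minimal : ∀ z → z < suc b → pos z ∈ W → bar z ∈ W → N z W ≢ suc z
    minimal z z<b _ z̄∈W with ∈-++⁻ (map pos X) z̄∈W
    ... | inj₁ p = case ∈-map⁻ pos p of λ ()
    ... | inj₂ (here refl) = contradiction z<b (<-irrefl refl)

  -- All of 1, ..., b + 1 and the final bar lie within b + 1, one letter too many, while every
  -- nonempty proper factor is admissible. Hence R₃ applies with z = b + 1.
  contraction : Plactic n (map pos (up 0 b ++ suc b ∷ C) ++ bar (suc b) ∷ []) (map pos (up 0 b ++ C))
  contraction = subst₂ (Plactic n) (++-identityʳ W) eq₂
    (relation (R₃ {z = suc b} (map pos U) (map pos C) [] column-W
      (λ A → 1+n≰n (≤-trans (≤-reflexive (sym N-b)) (IsAdmissible.bounded A (suc b) (s≤s z≤n) b<n)))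
      proper-factors eq N-b minimal) [])
    where
    eq : W ≡ map pos U ++ pos (suc b) ∷ map pos C ++ bar (suc b) ∷ []
    eq = trans (cong (_++ bar (suc b) ∷ []) (map-++ pos U (suc b ∷ C))) (++-assoc (map pos U) _ _)
    eq₂ : (map pos U ++ map pos C ++ []) ++ [] ≡ map pos (U ++ C)
    eq₂ = trans (++-identityʳ _) (trans (cong (map pos U ++_) (++-identityʳ _)) (sym (map-++ pos U C)))


-- The largest bar is read first. It cancels its letter b, the letters of [b+1, m] join C, and the
-- smaller bars then meet an intact 12⋯(b-1).
carve-plactic : ∀ {n m B C} → m ≤ n → Decreasing B → Letters m B →
                Increasing C → All (m <_) C → Letters n C →
                Plactic n (map pos (up 0 m ++ C) ++ map bar B) (map pos (carve m B C))
carve-plactic {n} {B = []} m≤n _ _ _ _ _ = ≡⇒plactic {n = n} (++-identityʳ _)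
carve-plactic {n} {m} {suc b ∷ B} {C} m≤n (b>B ∷ dB) r@((_ , b<m) ∷ _) iC m<C lC =
  ≡⇒plactic {n = n} (trans (cong (λ X → map pos X ++ bar (suc b) ∷ map bar B) split)
                           (sym (++-assoc (map pos (up 0 b ++ suc b ∷ V ++ C)) (bar (suc b) ∷ []) (map bar B)))) ◅◅
  plactic-++ʳ {n = n} (map bar B) (contraction (≤-trans b<m m≤n) iVC b<VC lVC) ◅◅
  carve-plactic (≤-trans (≤-trans (n≤1+n b) b<m) m≤n) dB (below-head b>B r)
    iVC (All.map (<-trans (n<1+n b)) b<VC) lVC
  where
  V = up (suc b) (m ∸ suc b)
  split : up 0 m ++ C ≡ up 0 b ++ suc b ∷ V ++ C
  split = trans (cong (_++ C) (up-split b m b<m)) (++-assoc (up 0 b) (suc b ∷ V) C)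
  iVC : Increasing (V ++ C)
  iVC = up-++-increasing iC (subst (λ m → All (m <_) C) (sym (m+[n∸m]≡n b<m)) m<C)
  b<VC : All (suc b <_) (V ++ C)
  b<VC = All.++⁺ (up-> (suc b) _) (All.map (≤-<-trans b<m) m<C)
  lVC : Letters n (V ++ C)
  lVC = All.++⁺ (All.tabulate λ p → ≤-trans (s≤s z≤n) (proj₁ (∈-up⁻ p)) ,
                  ≤-trans (proj₂ (∈-up⁻ p)) (≤-trans (≤-reflexive (m+[n∸m]≡n b<m)) m≤n)) lC

-- Inserting a column into 𝔠(p)

-- Unlike `N` it ignores bars, so it cannot be increased by passing to the right split form.
#≤pos : ℕ → Word → ℕ
#≤pos p = length ∘ filter (_≤ₗ? pos p)

#≤pos-++ : ∀ p u v → #≤pos p (u ++ v) ≡ #≤pos p u + #≤pos p v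
#≤pos-++ p u v = trans (cong length (filter-++ (_≤ₗ? pos p) u v)) (length-++ (filter (_≤ₗ? pos p) u))

#≤pos-pos : ∀ p X → #≤pos p (map pos X) ≡ #≤ p X
#≤pos-pos p []      = refl
#≤pos-pos p (x ∷ X) with x ≤? p
... | yes x≤p rewrite 𝟙≤-yes x≤p =
  trans (cong length (filter-accept (_≤ₗ? pos p) {pos x} {map pos X} (₁∼₁ x≤p))) (cong suc (#≤pos-pos p X))
... | no x≰p rewrite 𝟙≤-no (≰⇒> x≰p) =
  trans (cong length (filter-reject (_≤ₗ? pos p) {pos x} {map pos X} λ { (₁∼₁ x≤p) → x≰p x≤p })) (#≤pos-pos p X)

#≤pos-bar : ∀ p B → #≤pos p (map bar B) ≡ 0
#≤pos-bar p []      = refl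
#≤pos-bar p (_ ∷ B) = #≤pos-bar p B

#≤pos-filter : ∀ p {P : Letter → Set} (P? : Decidable P) u → #≤pos p (filter P? u) ≤ #≤pos p u
#≤pos-filter p P? u = filtered u
  where
  filtered : ∀ u → #≤pos p (filter P? u) ≤ #≤pos p u
  filtered [] = z≤n
  filtered (x ∷ u) with P? x | x ≤ₗ? pos p
  ... | yes _ | yes x≤p rewrite filter-accept (_≤ₗ? pos p) {x} {filter P? u} x≤p = s≤s (filtered u)
  ... | yes _ | no x≰p  rewrite filter-reject (_≤ₗ? pos p) {x} {filter P? u} x≰p = filtered u
  ... | no _  | yes _   = m≤n⇒m≤1+n (filtered u)
  ... | no _  | no _    = filtered u

-- The right split only exchanges bars for bars and sorts; sorting permutes, and filtering adds
-- nothing.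
#≤pos-rightSplit : ∀ n p u → #≤pos p (rightSplit n u) ≤ #≤pos p u
#≤pos-rightSplit n p u = begin
  #≤pos p (sort (kept ++ map bar ts))              ≡⟨ ↭-length (filter-↭ (_≤ₗ? pos p) (sort-↭ (kept ++ map bar ts))) ⟩
  #≤pos p (kept ++ map bar ts)                     ≡⟨ #≤pos-++ p kept (map bar ts) ⟩
  #≤pos p kept + #≤pos p (map bar ts)              ≡⟨ cong (#≤pos p kept +_) (#≤pos-bar p ts) ⟩
  #≤pos p kept + 0                                 ≡⟨ +-identityʳ _ ⟩
  #≤pos p kept                                     ≤⟨ #≤pos-filter p old? u ⟩
  #≤pos p u                                        ∎
  where
  open ≤-Reasoning
  old? = λ (x : Letter) → ¬? (x ∈? map bar (doubled n u))
  kept = filter old? u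
  ts = partners u (suc n) (doubled n u)

#≤pos-prefix : ∀ {p u v} → Prefix (flip _≤ₗ_) u v → All (_≤ₗ pos p) u → length u ≤ #≤pos p v
#≤pos-prefix         []                      []          = z≤n
#≤pos-prefix {p} {x ∷ u} {y ∷ v} (y≤x ∷ u≥v) (x≤p ∷ u≤p)
  rewrite filter-accept (_≤ₗ? pos p) {y} {v} (≤ₗ-trans y≤x x≤p) = s≤s (#≤pos-prefix u≥v u≤p)

-- Each of the p rows of 12⋯p would need an entry ≤ p in the right split of w.
few⇒¬⪯ : ∀ {n p w} .(a : w ≡ [] ⊎ IsAdmissible n w) .(pp : IsPositive n (up 0 p)) →
         #≤pos p w < p → ¬ (toACol w a ⪯ ⟨ up 0 p , pp ⟩)
few⇒¬⪯ {n} {p@(suc _)} {w@(_ ∷ _)} a pp few le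
  rewrite leftSplit-pos {n} (up-increasing 0 p) = 1+n≰n (≤-trans few (begin
    p                            ≡⟨ trans (length-map _ (up 0 p)) (length-up 0 p) ⟨
    length (map pos (up 0 p))    ≤⟨ #≤pos-prefix le (All.map⁺ (All.map ₁∼₁ (up-≤ 0 p))) ⟩
    #≤pos p (rightSplit n w)     ≤⟨ #≤pos-rightSplit n p w ⟩
    #≤pos p w                    ∎))
  where open ≤-Reasoning

-- The three shapes of an insertion result differ only in which of X and D are empty; as the empty
-- list is sent to `ε`, all three read ⟨X⟩⟨D⟩. A nonempty X with empty D is excluded by the counts.
inserted : ∀ {n X D} {c₁ c₂ : ACol n} (pX : IsPositive n X) (pD : IsPositive n D) →
           (∀ z → #≤ z X ≤ #≤ z D) →
           Plactic n (letters c₁ ++ letters c₂) (map pos X ++ map pos D) →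
           Inserted c₁ c₂ (⟨ X , pX ⟩ ∷ ⟨ D , pD ⟩ ∷ [])
inserted {X = []}    {[]}    pX pD X≤D c≡ = none (record { columns = [] ; tableau = [] ; plactic = c≡ })
inserted {n} {[]}    {d ∷ D} pX pD X≤D c≡ = one (record
  { columns = _ ∷ [] ; tableau = [-]
  ; plactic = c≡ ◅◅ ≡⇒plactic {n = n} (sym (++-identityʳ _)) })
inserted {X = x ∷ X} {[]}    pX pD X≤D c≡ = case prefix-pos (proj₁ pD) (proj₁ pX) X≤D of λ ()
inserted {n} {x ∷ X} {d ∷ D} pX pD X≤D c≡ = two (record
  { columns = _ ∷ _ ∷ [] ; tableau = ⪯-pos pD pX (proj₁ pD) (proj₁ pX) X≤D ∷ [-]
  ; plactic = c≡ ◅◅ ≡⇒plactic {n = n} (cong (map pos (x ∷ X) ++_) (sym (++-identityʳ _))) })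

-- Pigeonhole: as many distinct letters as the interval has places.
full⇒up : ∀ {a X} → Increasing X → All (a <_) X → All (_≤ a + length X) X → X ≡ up a (length X)
full⇒up [] [] [] = refl
full⇒up {a} {x ∷ X} (x<X ∷ iX) (a<x ∷ a<X) (x≤ ∷ X≤) =
  cong₂ _∷_ (sym 1+a≡x) (full⇒up iX (subst (λ x → All (x <_) X) (sym 1+a≡x) x<X) X≤′)
  where
  X≤′ : All (_≤ suc a + length X) X
  X≤′ = subst (λ m → All (_≤ m) X) (+-suc a (length X)) X≤
  x≤1+a : x ≤ suc a
  x≤1+a = +-cancelʳ-≤ (length X) x (suc a) (begin
    x + length X                                 ≡⟨ cong (x +_) (#≤-all X≤′) ⟨
    x + #≤ (suc a + length X) X                  ≤⟨ +-monoʳ-≤ x (#≤-increasing _ iX x<X) ⟩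
    x + (suc a + length X ∸ x)                   ≡⟨ m+[n∸m]≡n (≤-trans x≤ (≤-reflexive (+-suc a (length X)))) ⟩
    suc a + length X                             ∎)
    where open ≤-Reasoning
  1+a≡x : suc a ≡ x
  1+a≡x = ≤-antisym a<x x≤1+a

infix 4 _⟶*_
_⟶*_ : ∀ {n} → List (ACol n) → List (ACol n) → Set
_⟶*_ = Star _⟶_

≡⇒⟶* : ∀ {n} {cs ds : List (ACol n)} → cs ≡ ds → cs ⟶* ds
≡⇒⟶* refl = Star.ε

module _ {n p r : ℕ} {X B : List ℕ} (m≤n : p + r ≤ n)
         (X≤p : All (_≤ p) X) (B≤m : All (_≤ p + r) B)
         (pair : IsColumnPair n (X ++ up p r) B) where

  open IsColumnPair pair

  private
    m = p + r
    D = carve m B []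

    m≡ : up 0 p ++ up p r ≡ up 0 m
    m≡ = up-++ 0 p r

    p≤n : p ≤ n
    p≤n = ≤-trans (m≤m+n p r) m≤n

    pX : IsPositive n X
    pX = proj₁ (AllPairs-++⁻ X increasing) , All.++⁻ˡ X lettersX

    lB : Letters m B
    lB = All.zipWith (λ { ((1≤b , _) , b≤m) → 1≤b , b≤m }) (lettersB , B≤m)

    pD : IsPositive n D
    pD = carve-increasing decreasing lB [] [] , carve-letters decreasing lB m≤n

    #≤D : ∀ z → z ≤ m → #≤ z D + #≤ z B ≡ z
    #≤D z z≤m = trans (#≤-carve [] z decreasing lB) (trans (+-identityʳ _) (#≤-up z m z≤m))

    #≤XB : ∀ z → z ≤ m → #≤ z X + #≤ z (up p r) + #≤ z B ≤ z
    #≤XB z z≤m = subst (λ s → s + #≤ z B ≤ z) (#≤-++ z X (up p r)) (bounded z (≤-trans z≤m m≤n))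

    -- Up to z, the list D has exactly z letters less those of B, which is the room that
    -- admissibility leaves to X.
    X≤D-small : ∀ z → z ≤ m → #≤ z X ≤ #≤ z D
    X≤D-small z z≤m = +-cancelʳ-≤ (#≤ z B) _ _ (begin
      #≤ z X + #≤ z B                         ≤⟨ +-monoˡ-≤ (#≤ z B) (m≤m+n (#≤ z X) (#≤ z (up p r))) ⟩
      #≤ z X + #≤ z (up p r) + #≤ z B         ≤⟨ #≤XB z z≤m ⟩
      z                                       ≡⟨ #≤D z z≤m ⟨
      #≤ z D + #≤ z B                         ∎)
      where open ≤-Reasoning

    X≤m : All (_≤ m) X
    X≤m = All.map (λ x≤p → ≤-trans x≤p (m≤m+n p r)) X≤p

    X≤D : ∀ z → #≤ z X ≤ #≤ z D
    X≤D z with ≤-total z m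
    ... | inj₁ z≤m = X≤D-small z z≤m
    ... | inj₂ m≤z = begin
      #≤ z X      ≤⟨ #≤-≤length z X ⟩
      length X    ≡⟨ #≤-all X≤m ⟨
      #≤ m X      ≤⟨ X≤D-small m ≤-refl ⟩
      #≤ m D      ≤⟨ #≤-monotone D m≤z ⟩
      #≤ z D      ∎
      where open ≤-Reasoning

    W = map pos (X ++ up p r) ++ map bar B

    plactic-XD : Plactic n (map pos (up 0 p) ++ W) (map pos X ++ map pos D)
    plactic-XD =
      ≡⇒plactic {n = n} (trans (cong (λ v → map pos (up 0 p) ++ v ++ map bar B) (map-++ pos X (up p r)))
        (trans (cong (map pos (up 0 p) ++_) (++-assoc (map pos X) _ _)) (sym (++-assoc (map pos (up 0 p)) (map pos X) _)))) ◅◅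
      plactic-++ʳ {n = n} (map pos (up p r) ++ map bar B)
        (up-commutes* p≤n (All.zipWith (λ { ((1≤x , _) , x≤p) → 1≤x , x≤p }) (proj₂ pX , X≤p))) ◅◅
      ≡⇒plactic {n = n} (trans (++-assoc (map pos X) (map pos (up 0 p)) _) (cong (map pos X ++_)
        (trans (sym (++-assoc (map pos (up 0 p)) (map pos (up p r)) _))
          (cong (_++ map bar B) (trans (sym (map-++ pos (up 0 p) (up p r))) (cong (map pos) (trans m≡ (sym (++-identityʳ (up 0 m)))))))))) ◅◅
      plactic-++ˡ {n = n} (map pos X) (carve-plactic m≤n decreasing lB [] [] [])

    -- If X has p letters, then X and the run already use up the bound at z = m, which leaves no
    -- bar.
    full : length X ≡ p → X ≡ up 0 p × B ≡ []
    full eq = trans (full⇒up (proj₁ pX) (All.map proj₁ (proj₂ pX)) (subst (λ p → All (_≤ p) X) (sym eq) X≤p)) (cong (up 0) eq) , B≡[] B #B≤0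
      where
      B≡[] : ∀ B → length B ≤ 0 → B ≡ []
      B≡[] [] _ = refl
      #B≤0 : length B ≤ 0
      #B≤0 = +-cancelˡ-≤ m _ _ (begin
        m + length B                                ≡⟨ cong₂ _+_ (cong₂ _+_ (trans (#≤-all X≤m) eq) (trans (#≤-all (up-≤ p r)) (length-up p r))) (#≤-all B≤m) ⟨
        #≤ m X + #≤ m (up p r) + #≤ m B             ≤⟨ #≤XB m ≤-refl ⟩
        m                                           ≡⟨ +-identityʳ m ⟨
        m + 0                                       ∎)
        where open ≤-Reasoning

    W≡D : X ≡ up 0 p → B ≡ [] → W ≡ map pos D
    W≡D X≡ B≡ = begin
      map pos (X ++ up p r) ++ map bar B    ≡⟨ cong₂ (λ X B → map pos (X ++ up p r) ++ map bar B) X≡ B≡ ⟩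
      map pos (up 0 p ++ up p r) ++ []      ≡⟨ ++-identityʳ _ ⟩
      map pos (up 0 p ++ up p r)            ≡⟨ cong (map pos) (trans m≡ (sym (++-identityʳ (up 0 m)))) ⟩
      map pos (carve m [] [])               ≡⟨ cong (λ B → map pos (carve m B [])) B≡ ⟨
      map pos D                             ∎
      where open ≡-Reasoning

  -- A rule exists only when the two columns are out of order. If X has p letters, the second column
  -- is 12⋯m, the pair is already sorted and no step is taken. Otherwise the second column has too
  -- few letters ≤ p to satisfy `_⪯_`, and a single step yields X D.
  insert-into-𝔠 : ∀ .(a : W ≡ [] ⊎ IsAdmissible n W) .(p≤n : p ≤ n) .(pX : IsPositive n X) .(pD : IsPositive n D) →
                  𝔠 p p≤n ∷ toACol W a ∷ [] ⟶* ⟨ X , pX ⟩ ∷ ⟨ D , pD ⟩ ∷ []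
  insert-into-𝔠 a p≤n′ _ _ with length X ≟ p
  ... | yes eq with X≡ , B≡ ← full eq = ≡⇒⟶* (cong₂ (λ c d → c ∷ d ∷ [])
    (toACol-cong (trans (𝔠⁺≡up 0 p) (cong (map pos) (sym X≡))))
    (toACol-cong (W≡D X≡ B≡)))
  ... | no neq rewrite 𝔠≡ p p≤n′ = rule [] [] (few⇒¬⪯ a (up-positive p≤n) few)
      (inserted pX pD X≤D (subst₂ (λ v w → Plactic n (v ++ w) (map pos X ++ map pos D))
        (sym (letters-toACol (map pos (up 0 p)) _)) (sym (letters-toACol W a)) plactic-XD)) ◅ Star.ε
    where
    few : #≤pos p W < p
    few = begin-strict
      #≤pos p W                                                    ≡⟨ #≤pos-++ p (map pos (X ++ up p r)) (map bar B) ⟩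
      #≤pos p (map pos (X ++ up p r)) + #≤pos p (map bar B)        ≡⟨ cong₂ _+_ (#≤pos-pos p (X ++ up p r)) (#≤pos-bar p B) ⟩
      #≤ p (X ++ up p r) + 0                                       ≡⟨ cong (_+ 0) (#≤-++ p X (up p r)) ⟩
      #≤ p X + #≤ p (up p r) + 0                                   ≡⟨ cong (λ x → #≤ p X + x + 0) (#≤-none (up-> p r)) ⟩
      #≤ p X + 0 + 0                                               ≡⟨ trans (+-identityʳ _) (+-identityʳ _) ⟩
      #≤ p X                                                       <⟨ ≤∧≢⇒< (#≤-increasing p (proj₁ pX) (All.map proj₁ (proj₂ pX))) (neq ∘ trans (sym (#≤-all X≤p))) ⟩
      p                                                            ∎
      where open ≤-Reasoning

-- Inserting a column into a sorted product of columns 𝔠(p)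

⟶*-++ˡ : ∀ {n} xs {cs ds : List (ACol n)} → cs ⟶* ds → xs ++ cs ⟶* xs ++ ds
⟶*-++ˡ []       r = r
⟶*-++ˡ (x ∷ xs) r = Star.gmap (x ∷_) (λ { (rule xs ys c₂⋠c₁ ins) → rule (x ∷ xs) ys c₂⋠c₁ ins }) (⟶*-++ˡ xs r)

⟶*-++ʳ : ∀ {n} ys {cs ds : List (ACol n)} → cs ⟶* ds → cs ++ ys ⟶* ds ++ ys
⟶*-++ʳ {n} zs = Star.gmap (_++ zs) λ { (rule xs ys {c₁} {c₂} {r} c₂⋠c₁ ins) →
  subst₂ _⟶_ (sym (++-assoc xs (c₁ ∷ c₂ ∷ ys) zs))
             (sym (trans (++-assoc xs (r ++ ys) zs) (cong (xs ++_) (++-assoc r ys zs))))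
             (rule xs (ys ++ zs) c₂⋠c₁ ins) }

-- The list is read from right to left.
cols : ∀ {n} (L : List ℕ) → .(All (_≤ n) L) → List (ACol n)
cols []      _ = []
cols (p ∷ L) a = cols L (All.tail a) ++ 𝔠 p (All.head a) ∷ []

record Sorting {n} (cs : List (ACol n)) : Set where
  constructor sorting
  field
    {heights}  : List ℕ
    descending : Descending heights
    heights≤n  : All (_≤ n) heights
    reduces    : cs ⟶* cols heights heights≤n

open Sorting

-- Runs of letters and dominance

-- The predecessor of the least letter is too small to lie in X, so it is a; the argument then
-- repeats one letter higher.
run : ∀ {a X} → Increasing X → All (a <_) X → (∀ {i} → suc i ∈ X → i ∈ X ⊎ i ≡ a) → X ≡ up a (length X)
run [] [] _ = refl
run {a} {suc i ∷ X} (i<X ∷ iX) (_ ∷ a<X) pred∈ with pred∈ (here refl)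
... | inj₁ (here ())
... | inj₁ (there i∈X) = contradiction (<-trans (n<1+n i) (All.lookup i<X i∈X)) (<-irrefl refl)
... | inj₂ refl        = cong (suc a ∷_) (run iX i<X pred∈X)
  where
  pred∈X : ∀ {j} → suc j ∈ X → j ∈ X ⊎ j ≡ suc a
  pred∈X p with pred∈ (there p)
  ... | inj₁ (here eq) = inj₂ eq
  ... | inj₁ (there q) = inj₁ q
  ... | inj₂ refl      = contradiction (All.lookup i<X p) (<-irrefl refl)

split-run : ∀ {p X} → Increasing X → (∀ {i} → suc i ∈ X → p ≤ i → i ∈ X ⊎ i ≡ p) →
            ∃[ Y ] ∃[ r ] All (_≤ p) Y × X ≡ Y ++ up p r
split-run {X = []} _ _ = [] , 0 , [] , refl
split-run {p} {x ∷ X} (x<X ∷ iX) pred∈ with x ≤? p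
... | yes x≤p = let Y , r , Y≤p , eq = split-run iX pred∈X in x ∷ Y , r , x≤p ∷ Y≤p , cong (x ∷_) eq
  where
  pred∈X : ∀ {i} → suc i ∈ X → p ≤ i → i ∈ X ⊎ i ≡ p
  pred∈X s p≤i with pred∈ (there s) p≤i
  ... | inj₁ (here refl) = inj₂ (≤-antisym x≤p p≤i)
  ... | inj₁ (there q)   = inj₁ q
  ... | inj₂ eq          = inj₂ eq
... | no x≰p = [] , length (x ∷ X) , [] , run (x<X ∷ iX) p<X (λ s → pred∈ s (≤-pred (All.lookup p<X s)))
  where
  p<X : All (p <_) (x ∷ X)
  p<X = ≰⇒> x≰p ∷ All.map (<-trans (≰⇒> x≰p)) x<X

up-bound : ∀ {p n} r → p ≤ n → Letters n (up p r) → p + r ≤ n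
up-bound {p} zero    p≤n _  = subst (_≤ _) (sym (+-identityʳ p)) p≤n
up-bound {p} (suc r) p≤n lX = proj₂ (All.lookup lX (∈-up⁺ (m<m+n p (s≤s z≤n)) ≤-refl))

-- Reading X after the columns of heights L keeps all weights dominant.
Dominant⁺ : List ℕ → List ℕ → Set
Dominant⁺ L X = ∀ {i} → suc i ∈ X → i ∈ X ⊎ i ≡ 0 ⊎ i ∈ L

-- M arises from L and an empty column when each letter i+1 of X turns a
-- column of height i into one of height i+1.
Raises : List ℕ → List ℕ → List ℕ → Set
Raises L X M = ∀ i → #≤ i M + #≤ (suc i) X ≡ suc (#≤ i L + #≤ i X)

-- From p upwards everything in L and X is counted, so the count of M is constant there and no
-- height can exceed p. This keeps the list of heights descending after an insertion.
raises-bounded : ∀ {p L X M} → All (_≤ p) L → All (_≤ p) X → Raises L X M → All (_≤ p) M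
raises-bounded {p} {L} {X} {M} L≤p X≤p raises = All.tabulate bound
  where
  count : ∀ i → p ≤ i → #≤ i M ≡ suc (length L)
  count i p≤i = +-cancelʳ-≡ (length X) _ _ (begin
    #≤ i M + length X          ≡⟨ cong (#≤ i M +_) (#≤-all (All.map (λ x≤p → ≤-trans x≤p (m≤n⇒m≤1+n p≤i)) X≤p)) ⟨
    #≤ i M + #≤ (suc i) X      ≡⟨ raises i ⟩
    suc (#≤ i L + #≤ i X)      ≡⟨ cong suc (cong₂ _+_ (#≤-all (All.map (λ x≤p → ≤-trans x≤p p≤i) L≤p)) (#≤-all (All.map (λ x≤p → ≤-trans x≤p p≤i) X≤p))) ⟩
    suc (length L) + length X  ∎)
    where open ≡-Reasoning
  bound : ∀ {z} → z ∈ M → z ≤ p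
  bound {zero}  z∈M = z≤n
  bound {suc z} z∈M with suc z ≤? p
  ... | yes z<p = z<p
  ... | no z≮p  = contradiction (subst₂ _<_ (count z p≤z) (count (suc z) (m≤n⇒m≤1+n p≤z)) (∈⇒#≤-jump z∈M)) (<-irrefl refl)
    where p≤z = ≤-pred (≰⇒> z≮p)

raises-∷ : ∀ {p L Y M} r → Raises L Y M → Raises (p ∷ L) (Y ++ up p r) (p + r ∷ M)
raises-∷ {p} {L} {Y} {M} r raises i = begin
  𝟙≤ (p + r) i + #≤ i M + #≤ (suc i) (Y ++ up p r)                     ≡⟨ cong (𝟙≤ (p + r) i + #≤ i M +_) (#≤-++ (suc i) Y (up p r)) ⟩
  𝟙≤ (p + r) i + #≤ i M + (#≤ (suc i) Y + #≤ (suc i) (up p r))         ≡⟨ regroup (𝟙≤ (p + r) i) _ _ _ ⟩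
  (𝟙≤ (p + r) i + #≤ (suc i) (up p r)) + (#≤ i M + #≤ (suc i) Y)       ≡⟨ cong₂ _+_ (#≤-up-shift p r i) (raises i) ⟩
  (𝟙≤ p i + #≤ i (up p r)) + suc (#≤ i L + #≤ i Y)                     ≡⟨ regroup′ (𝟙≤ p i) (#≤ i (up p r)) (#≤ i L) (#≤ i Y) ⟩
  suc (𝟙≤ p i + #≤ i L + (#≤ i Y + #≤ i (up p r)))                     ≡⟨ cong (λ y → suc (𝟙≤ p i + #≤ i L + y)) (#≤-++ i Y (up p r)) ⟨
  suc (𝟙≤ p i + #≤ i L + #≤ i (Y ++ up p r))                           ∎
  where
  open ≡-Reasoning
  regroup : ∀ a b c d → a + b + (c + d) ≡ (a + d) + (b + c)
  regroup = solve-∀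
  regroup′ : ∀ a b c d → (a + b) + suc (c + d) ≡ suc (a + c + (d + b))
  regroup′ = solve-∀

module _ {n p : ℕ} {L : List ℕ} (L≤p : All (p ≥_) L) (aL : All (_≤ n) (p ∷ L)) where

  private
    p≤n = All.head aL

  -- Heights in L are at most p, so the only height from which letters above p can start is p
  -- itself.
  dominant-split : ∀ {X} → Increasing X → Dominant⁺ (p ∷ L) X → ∃[ Y ] ∃[ r ] All (_≤ p) Y × X ≡ Y ++ up p r
  dominant-split {X} iX dom = split-run iX pred∈
    where
    pred∈ : ∀ {i} → suc i ∈ X → p ≤ i → i ∈ X ⊎ i ≡ p
    pred∈ s p≤i with dom s
    ... | inj₁ i∈X                   = inj₁ i∈X
    ... | inj₂ (inj₁ refl)           = inj₂ (sym (n≤0⇒n≡0 p≤i))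
    ... | inj₂ (inj₂ (here eq))      = inj₂ eq
    ... | inj₂ (inj₂ (there i∈L))    = inj₂ (≤-antisym (All.lookup L≤p i∈L) p≤i)

  -- A letter i + 1 of Y is at most p, so its predecessor i is neither the height p nor a letter of
  -- the run above p.
  dominant-tail : ∀ {Y r} → All (_≤ p) Y → Dominant⁺ (p ∷ L) (Y ++ up p r) → Dominant⁺ L Y
  dominant-tail {Y} {r} Y≤p dom s with dom (∈-++⁺ˡ s)
  ... | inj₂ (inj₁ eq)          = inj₂ (inj₁ eq)
  ... | inj₂ (inj₂ (here refl)) = contradiction (All.lookup Y≤p s) 1+n≰n
  ... | inj₂ (inj₂ (there i∈L)) = inj₂ (inj₂ i∈L)
  ... | inj₁ i∈ with ∈-++⁻ Y i∈
  ...   | inj₁ i∈Y = inj₁ i∈Y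
  ...   | inj₂ i∈U = contradiction (≤-trans (proj₁ (∈-up⁻ i∈U)) (<⇒≤ (All.lookup Y≤p s))) (<-irrefl refl)

  insert-top : ∀ {Y r B} (m≤n : p + r ≤ n) (Y≤p : All (_≤ p) Y) (B≤m : All (_≤ p + r) B)
               (pair : IsColumnPair n (Y ++ up p r) B) .(a : _) .(pY : IsPositive n Y) .(pD : IsPositive n (carve (p + r) B []))
               (S : Sorting {n} (cols L (All.tail aL) ++ ⟨ Y , pY ⟩ ∷ [])) →
               cols (p ∷ L) aL ++ toACol (map pos (Y ++ up p r) ++ map bar B) a ∷ [] ⟶*
               cols (heights S) (heights≤n S) ++ ⟨ carve (p + r) B [] , pD ⟩ ∷ []
  insert-top m≤n Y≤p B≤m pair a pY pD S =
    ≡⇒⟶* (++-assoc (cols L (All.tail aL)) _ _) ◅◅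
    ⟶*-++ˡ (cols L (All.tail aL)) (insert-into-𝔠 m≤n Y≤p B≤m pair a p≤n pY pD) ◅◅
    ≡⇒⟶* (sym (++-assoc (cols L (All.tail aL)) _ _)) ◅◅
    ⟶*-++ʳ _ (reduces S)

positive-pair : ∀ {n X} → IsPositive n X → IsColumnPair n X []
positive-pair (iX , lX) = record
  { increasing = iX ; decreasing = [] ; lettersX = lX ; lettersB = []
  ; bounded = λ z _ → ≤-trans (≤-reflexive (+-identityʳ _)) (#≤-increasing z iX (All.map proj₁ lX)) }

++⁻ˡ-positive : ∀ {n} X {Y} → IsPositive n (X ++ Y) → IsPositive n X
++⁻ˡ-positive X (iX , lX) = proj₁ (AllPairs-++⁻ X iX) , All.++⁻ˡ X lX

-- Without bars D is 12⋯(p + r), already of the required form, and the rest Y moves on to the next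
-- column to the left. When no column is left, dominance forces the remaining letters to be 12⋯r.
insert-positive : ∀ {n} L (aL : All (_≤ n) L) → Descending L → ∀ X (pX : IsPositive n X) → Dominant⁺ L X →
                  ∃[ S ] Raises L X (heights {n} {cols L aL ++ ⟨ X , pX ⟩ ∷ []} S)
insert-positive {n} [] [] [] X pX@(iX , lX) dom
  = sorting ([] ∷ []) (r≤n ∷ []) (≡⇒⟶* (cong (_∷ []) (toACol-cong (trans (cong (map pos) X≡up) (sym (𝔠⁺≡up 0 (length X)))))))
  , raises
  where
  pred∈ : ∀ {i} → suc i ∈ X → i ∈ X ⊎ i ≡ 0
  pred∈ s with dom s
  ... | inj₁ i∈X         = inj₁ i∈X
  ... | inj₂ (inj₁ refl) = inj₂ refl
  X≡up : X ≡ up 0 (length X)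
  X≡up = run iX (All.map proj₁ lX) pred∈
  r≤n : length X ≤ n
  r≤n = up-bound (length X) z≤n (subst (Letters n) X≡up lX)
  raises : Raises [] X (length X ∷ [])
  raises i = trans (cong₂ _+_ (+-identityʳ (𝟙≤ (length X) i)) (cong (#≤ (suc i)) X≡up))
    (trans (#≤-up-shift 0 (length X) i) (cong (suc ∘ #≤ i) (sym X≡up)))
insert-positive {n} (p ∷ L) aL@(p≤n ∷ _) (L≤p ∷ dL) X pX@(iX , lX) dom
  with Y , r , Y≤p , refl ← dominant-split L≤p aL iX dom
  with S , raises ← insert-positive L (All.tail aL) dL Y (++⁻ˡ-positive Y pX) (dominant-tail L≤p aL Y≤p dom)
  = sorting
      (All.map (λ x≤p → ≤-trans x≤p (m≤m+n p r)) (raises-bounded L≤p Y≤p raises) ∷ descending S)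
      (m≤n ∷ heights≤n S)
      (≡⇒⟶* (cong (λ c → cols (p ∷ L) aL ++ c ∷ []) (toACol-cong (sym (++-identityʳ _)))) ◅◅
       insert-top L≤p aL m≤n Y≤p [] (positive-pair pX) (subst (λ w → w ≡ [] ⊎ IsAdmissible n w) (sym (++-identityʳ _)) (isAdmissible-pos′ {X = X} pX)) pY pD S ◅◅
       ≡⇒⟶* (cong (λ c → cols (heights S) (heights≤n S) ++ c ∷ [])
         (toACol-cong (trans (cong (map pos) (++-identityʳ (up 0 (p + r)))) (sym (𝔠⁺≡up 0 (p + r)))))))
  , raises-∷ {p} {L} {Y} {heights S} r raises
  where
  pY : IsPositive n Y
  pY = ++⁻ˡ-positive Y pX
  m≤n : p + r ≤ n
  m≤n = up-bound r p≤n (All.++⁻ʳ Y lX)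
  pD : IsPositive n (up 0 (p + r) ++ [])
  pD = subst (IsPositive n) (sym (++-identityʳ _)) (up-positive m≤n)

-- Barred letters and general columns

-- Larger bars come first: the bar of i needs a column of height i, either present in M or just
-- produced by the bar of i + 1.
Dominant⁻ : List ℕ → List ℕ → Set
Dominant⁻ M B = ∀ {i} → i ∈ B → suc i ∈ B ⊎ i ∈ M

-- Each letter i of B, read as ī, turns a column of height i into one of height i-1.
Lowers : List ℕ → List ℕ → List ℕ → Set
Lowers M B L = ∀ i → #≤ i L + #≤ i B ≡ #≤ i M + #≤ (suc i) B

-- The chain b, b + 1, ... inside B cannot pass n, so it ends at a height of M, which is at most m.
dominant⁻-bounded : ∀ {n m M B} → Letters n B → All (_≤ m) M → Dominant⁻ M B → All (_≤ m) B
dominant⁻-bounded {n} {m} {M} {B} lB M≤m dom = All.tabulate λ {b} b∈B → bound n b b∈B (m≤n+m n b)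
  where
  -- `k` is fuel: n ≤ b + k limits the length of the chain.
  bound : ∀ k b → b ∈ B → n ≤ b + k → b ≤ m
  bound k b b∈B n≤ with dom b∈B
  ... | inj₂ b∈M = All.lookup M≤m b∈M
  bound zero b b∈B n≤ | inj₁ s = contradiction
    (≤-trans (proj₂ (All.lookup lB s)) (≤-trans n≤ (≤-reflexive (+-identityʳ b)))) 1+n≰n
  bound (suc k) b b∈B n≤ | inj₁ s = <⇒≤ (bound k (suc b) s (≤-trans n≤ (≤-reflexive (+-suc b k))))

-- If i + 1 is in D but i ≥ 1 is not, then i is in B. Dominance of B offers i + 1 ∈ B, impossible as
-- i + 1 ∈ D, or i = m, impossible as i + 1 ≤ m, or i ∈ L, as wanted.
carve-dominant : ∀ {m B L} → Decreasing B → Letters m B → Dominant⁻ (m ∷ L) B → Dominant⁺ L (carve m B [])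
carve-dominant dB lB dom {zero}  _ = inj₂ (inj₁ refl)
carve-dominant {B = B} dB lB dom {suc i} s with ∈-carve⁻ dB lB s
... | inj₁ (_ , i<m , si∉B) with suc i ∈ℕ? B
...   | no i∉B  = inj₁ (∈-carve⁺ dB lB (s≤s z≤n) (<⇒≤ i<m) i∉B)
...   | yes i∈B with dom i∈B
...     | inj₁ si∈B          = contradiction si∈B si∉B
...     | inj₂ (here refl)   = contradiction i<m 1+n≰n
...     | inj₂ (there i∈L)   = inj₂ (inj₂ i∈L)

-- The bars B applied to the column of height m have the same effect as the
-- letters of [1, m] outside B applied to an empty column.
carve-lowers : ∀ {m B L M} → Decreasing B → Letters m B → Raises L (carve m B []) M → Lowers (m ∷ L) B M
carve-lowers {m} {B} {L} {M} dB lB raises i = +-cancelʳ-≡ (#≤ (suc i) D) _ _ (begin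
  #≤ i M + #≤ i B + #≤ (suc i) D                              ≡⟨ regroup (#≤ i M) (#≤ i B) _ ⟩
  #≤ i M + #≤ (suc i) D + #≤ i B                              ≡⟨ cong (_+ #≤ i B) (raises i) ⟩
  suc (#≤ i L + #≤ i D) + #≤ i B                              ≡⟨ cong suc (+-assoc (#≤ i L) _ _) ⟩
  suc (#≤ i L + (#≤ i D + #≤ i B))                            ≡⟨ cong (λ x → suc (#≤ i L + x)) (#≤D i) ⟩
  suc (#≤ i L + #≤ i (up 0 m))                                ≡⟨ +-suc (#≤ i L) _ ⟨
  #≤ i L + suc (#≤ i (up 0 m))                                ≡⟨ cong (#≤ i L +_) (#≤-up-shift 0 m i) ⟨
  #≤ i L + (𝟙≤ m i + #≤ (suc i) (up 0 m))                     ≡⟨ cong (λ x → #≤ i L + (𝟙≤ m i + x)) (#≤D (suc i)) ⟨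
  #≤ i L + (𝟙≤ m i + (#≤ (suc i) D + #≤ (suc i) B))           ≡⟨ regroup′ (#≤ i L) (𝟙≤ m i) _ _ ⟩
  𝟙≤ m i + #≤ i L + #≤ (suc i) B + #≤ (suc i) D               ∎)
  where
  open ≡-Reasoning
  D = carve m B []
  #≤D : ∀ z → #≤ z D + #≤ z B ≡ #≤ z (up 0 m)
  #≤D z = trans (#≤-carve [] z dB lB) (+-identityʳ _)
  regroup : ∀ a b c → a + b + c ≡ a + c + b
  regroup = solve-∀
  regroup′ : ∀ a b c d → a + (b + (c + d)) ≡ b + a + d + c
  regroup′ = solve-∀

raises-unique : ∀ {L X M M′} → Raises L X M → Raises L X M′ → M ≈ M′
raises-unique {X = X} r r′ i = +-cancelʳ-≡ (#≤ (suc i) X) _ _ (trans (r i) (sym (r′ i)))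

-- Two unbarred insertions: Y into L, then D into the result. The intermediate heights M are
-- prescribed from outside so that a tree can supply its outer valuations.
insert-column : ∀ {n} p L (aL : All (_≤ n) (p ∷ L)) → Descending (p ∷ L) →
                ∀ {X B M} → IsColumnPair n X B → .(a : map pos X ++ map bar B ≡ [] ⊎ IsAdmissible n (map pos X ++ map bar B)) →
                Dominant⁺ (p ∷ L) X → Raises (p ∷ L) X M → Dominant⁻ M B →
                ∃[ S ] Lowers M B (heights {n} {cols (p ∷ L) aL ++ toACol (map pos X ++ map bar B) a ∷ []} S)
insert-column {n} p L aL@(p≤n ∷ _) (L≤p ∷ dL) {X} {B} {M} pair a dom⁺ raises dom⁻
  with Y , r , Y≤p , refl ← dominant-split L≤p aL (IsColumnPair.increasing pair) dom⁺
  = sorting (descending S₂) (heights≤n S₂)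
      (insert-top L≤p aL m≤n Y≤p B≤m pair a pY pD S₁ ◅◅ reduces S₂)
  , λ i → trans (carve-lowers {L = heights S₁} {heights S₂} decreasing lB (proj₂ inserted₂) i) (cong (_+ #≤ (suc i) B) (M₁≈M i))
  where
  open IsColumnPair pair
  m = p + r
  m≤n : m ≤ n
  m≤n = up-bound r p≤n (All.++⁻ʳ Y lettersX)
  pY : IsPositive n Y
  pY = ++⁻ˡ-positive Y (increasing , lettersX)
  inserted₁ = insert-positive L (All.tail aL) dL Y pY (dominant-tail L≤p aL Y≤p dom⁺)
  S₁ = proj₁ inserted₁
  M₁≤m : All (_≤ m) (m ∷ heights S₁)
  M₁≤m = ≤-refl ∷ All.map (λ x≤p → ≤-trans x≤p (m≤m+n p r)) (raises-bounded L≤p Y≤p (proj₂ inserted₁))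
  -- `Raises` determines its result as a multiset, so the heights found by insertion may replace the
  -- prescribed M.
  M₁≈M : m ∷ heights S₁ ≈ M
  M₁≈M = raises-unique {p ∷ L} {Y ++ up p r} {m ∷ heights S₁} {M} (raises-∷ {p} {L} {Y} {heights S₁} r (proj₂ inserted₁)) raises
  dom⁻₁ : Dominant⁻ (m ∷ heights S₁) B
  dom⁻₁ b∈B with dom⁻ b∈B
  ... | inj₁ s   = inj₁ s
  ... | inj₂ b∈M = inj₂ (∈-resp-≈ {M} {m ∷ heights S₁} (sym ∘ M₁≈M) b∈M)
  B≤m : All (_≤ m) B
  B≤m = dominant⁻-bounded lettersB M₁≤m dom⁻₁
  lB : Letters m B
  lB = All.zipWith (λ { ((1≤b , _) , b≤m) → 1≤b , b≤m }) (lettersB , B≤m)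
  pD : IsPositive n (carve m B [])
  pD = carve-increasing decreasing lB [] [] , carve-letters decreasing lB m≤n
  inserted₂ = insert-positive (heights S₁) (heights≤n S₁) (descending S₁) (carve m B []) pD (carve-dominant decreasing lB dom⁻₁)
  S₂ = proj₁ inserted₂

-- Normal forms

normal : ∀ {n} {cs : List (ACol n)} → Linked (flip _⪯_) cs → IsNormalForm _⟶_ cs
normal cs↗ (_ , rule xs ys c₂⋠c₁ _) = c₂⋠c₁ (adjacent xs cs↗)
  where
  adjacent : ∀ {a ℓ} {A : Set a} {R : Rel A ℓ} {x y ys} xs → Linked R (xs ++ x ∷ y ∷ ys) → R x y
  adjacent []       (r ∷ _) = r
  adjacent (_ ∷ xs) rs      = adjacent xs (Linked.tail rs)

𝔠-antitone : ∀ {n p m} .(p≤n : p ≤ n) .(m≤n : m ≤ n) → m ≤ p → 𝔠 p p≤n ⪯ 𝔠 m m≤n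
𝔠-antitone {n} {p} {m} p≤n m≤n m≤p rewrite 𝔠≡ p p≤n | 𝔠≡ m m≤n =
  ⪯-pos (up-positive p≤n) (up-positive m≤n) (up-increasing 0 p) (up-increasing 0 m) λ z → begin
    #≤ z (up 0 m)                          ≤⟨ m≤m+n _ (#≤ z (up m (p ∸ m))) ⟩
    #≤ z (up 0 m) + #≤ z (up m (p ∸ m))    ≡⟨ #≤-++ z (up 0 m) _ ⟨
    #≤ z (up 0 m ++ up m (p ∸ m))          ≡⟨ cong (#≤ z) (trans (up-++ 0 m (p ∸ m)) (cong (up 0) (m+[n∸m]≡n m≤p))) ⟩
    #≤ z (up 0 p)                          ∎
  where open ≤-Reasoning

cols-sorted : ∀ {n} L (aL : All (_≤ n) L) → Descending L → AllPairs (flip _⪯_) (cols L aL)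
cols-sorted []      []         []         = []
cols-sorted {n} (p ∷ L) (p≤n ∷ aL) (L≤p ∷ dL) =
  AllPairs.++⁺ (cols-sorted L aL dL) ([] ∷ []) (All.map (λ c → c ∷ []) (below L aL L≤p))
  where
  below : ∀ L (aL : All (_≤ n) L) → All (p ≥_) L → All (𝔠 p p≤n ⪯_) (cols L aL)
  below []      []       []          = []
  below (m ∷ L) (m≤n ∷ aL) (m≤p ∷ L≤p) = All.++⁺ (below L aL L≤p) (𝔠-antitone p≤n m≤n m≤p ∷ [])

cols-normal : ∀ {n} L (aL : All (_≤ n) L) → Descending L → IsNormalForm _⟶_ (cols L aL)
cols-normal L aL dL = normal (Linked.AllPairs⇒Linked (cols-sorted L aL dL))

-- Sorting arbitrary products of columns 𝔠(m)

-- Unlike `cols` it is written from left to right, and it will be used for lists in any order.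
row : ∀ {n} (L : List ℕ) → .(All (_≤ n) L) → List (ACol n)
row []      _ = []
row (m ∷ L) a = 𝔠 m (All.head a) ∷ row L (All.tail a)

-- The letters 1, ..., m in total have the effect of raising the extra empty column to height m, so
-- m is simply added to the multiset.
insert-𝔠 : ∀ {n} L (aL : All (_≤ n) L) → Descending L → ∀ m .(m≤n : m ≤ n) →
           ∃[ S ] heights {n} {cols L aL ++ 𝔠 m m≤n ∷ []} S ≈ m ∷ L
insert-𝔠 {n} L aL dL m m≤n′ = S′ , raised
  where
  m≤n : m ≤ n
  m≤n = recompute (m ≤? n) m≤n′
  dominant : Dominant⁺ L (up 0 m)
  dominant {zero}  _ = inj₂ (inj₁ refl)
  dominant {suc i} s = inj₁ (∈-up⁺ (s≤s z≤n) (<⇒≤ (proj₂ (∈-up⁻ s))))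
  inserted-up = insert-positive L aL dL (up 0 m) (up-positive m≤n) dominant
  S = proj₁ inserted-up
  S′ = sorting (descending S) (heights≤n S)
         (≡⇒⟶* (cong (λ c → cols L aL ++ c ∷ []) (𝔠≡ m m≤n)) ◅◅ reduces S)
  raised : ∀ z → #≤ z (heights S) ≡ 𝟙≤ m z + #≤ z L
  raised z = +-cancelʳ-≡ (#≤ (suc z) (up 0 m)) _ _ (begin
    #≤ z (heights S) + #≤ (suc z) (up 0 m)          ≡⟨ proj₂ inserted-up z ⟩
    suc (#≤ z L + #≤ z (up 0 m))                    ≡⟨ +-suc (#≤ z L) _ ⟨
    #≤ z L + suc (#≤ z (up 0 m))                    ≡⟨ cong (#≤ z L +_) (#≤-up-shift 0 m z) ⟨
    #≤ z L + (𝟙≤ m z + #≤ (suc z) (up 0 m))         ≡⟨ x∙yz≈y∙xz (#≤ z L) (𝟙≤ m z) _ ⟩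
    𝟙≤ m z + (#≤ z L + #≤ (suc z) (up 0 m))         ≡⟨ +-assoc (𝟙≤ m z) _ _ ⟨
    𝟙≤ m z + #≤ z L + #≤ (suc z) (up 0 m)           ∎)
    where open ≡-Reasoning

sort-row : ∀ {n} M (aM : All (_≤ n) M) → ∃[ S ] heights {n} {row M aM} S ≈ M
sort-row {n} M aM = let S , eq = insert-row [] [] [] M aM in S , λ z → trans (eq z) (+-identityʳ _)
  where
  insert-row : ∀ L (aL : All (_≤ n) L) → Descending L → ∀ M (aM : All (_≤ n) M) →
               ∃[ S ] (∀ z → #≤ z (heights {n} {cols L aL ++ row M aM} S) ≡ #≤ z M + #≤ z L)
  insert-row L aL dL []      []         = sorting dL aL (≡⇒⟶* (++-identityʳ _)) , λ z → refl
  insert-row L aL dL (m ∷ M) (m≤n ∷ aM) =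
    let S  , eq  = insert-𝔠 L aL dL m m≤n
        S′ , eq′ = insert-row (heights S) (heights≤n S) (descending S) M aM
    in sorting (descending S′) (heights≤n S′)
         (≡⇒⟶* (sym (++-assoc (cols L aL) _ _)) ◅◅ ⟶*-++ʳ (row M aM) (reduces S) ◅◅ reduces S′)
     , λ z → trans (eq′ z) (trans (cong (#≤ z M +_) (eq z))
         (trans (x∙yz≈y∙xz (#≤ z M) (𝟙≤ m z) _) (sym (+-assoc (𝟙≤ m z) _ _))))

cols-unique : ∀ {n} {L M} {aL : All (_≤ n) L} {aM : All (_≤ n) M} →
              Descending L → Descending M → L ≈ M → cols L aL ≡ cols M aM
cols-unique dL dM eq with refl ← ≈⇒≡ dL dM eq = refl

-- Readings of C-trees

𝔠⁻≡down : ∀ a c → 𝔠⁻ a c ≡ map bar (down a c)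
𝔠⁻≡down a zero    = refl
𝔠⁻≡down a (suc c) = cong (bar a ∷_) (𝔠⁻≡down (pred a) c)

up-predecessor : ∀ {a b i} → suc i ∈ up a b → i ∈ up a b ⊎ i ≡ a
up-predecessor {b = suc b} (here refl) = inj₂ refl
up-predecessor {b = suc b} (there p) with up-predecessor p
... | inj₁ q    = inj₁ (there q)
... | inj₂ refl = inj₁ (here refl)

down-successor : ∀ {a c i} → i ∈ down a c → suc i ∈ down a c ⊎ i ≡ a
down-successor {c = suc c} (here refl) = inj₂ refl
down-successor {a} {suc c} (there p) with down-successor p
... | inj₁ q = inj₁ (there q)
-- As `pred 0` is 0, a block starting at 0 repeats 0, and its tail again starts at a.
down-successor {zero}  {suc c} (there p) | inj₂ refl = inj₂ refl
down-successor {suc a} {suc c} (there p) | inj₂ refl = inj₁ (here refl)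

++-up-predecessor : ∀ {a b X L i} → (suc i ∈ X → i ∈ X ⊎ i ∈ L) →
                    suc i ∈ up a b ++ X → i ∈ up a b ++ X ⊎ i ∈ a ∷ L
++-up-predecessor {a} {b} pred∈ s with ∈-++⁻ (up a b) s
... | inj₁ p with up-predecessor p
...   | inj₁ q    = inj₁ (∈-++⁺ˡ q)
...   | inj₂ refl = inj₂ (here refl)
++-up-predecessor {a} {b} pred∈ s | inj₂ p with pred∈ p
...   | inj₁ q    = inj₁ (∈-++⁺ʳ (up a b) q)
...   | inj₂ q    = inj₂ (there q)

++-down-dominant : ∀ {a c B L} → Dominant⁻ L B → Dominant⁻ (a ∷ L) (B ++ down a c)
++-down-dominant {B = B} dom p with ∈-++⁻ B p
... | inj₂ q with down-successor q
...   | inj₁ r    = inj₁ (∈-++⁺ʳ B r)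
...   | inj₂ refl = inj₂ (here refl)
++-down-dominant {B = B} dom p | inj₁ q with dom q
...   | inj₁ r    = inj₁ (∈-++⁺ˡ r)
...   | inj₂ r    = inj₂ (there r)

++-up-shift : ∀ {a a′ b M X L z} → a′ ≡ a + b →
              #≤ z M + #≤ (suc z) X ≡ #≤ z L + #≤ z X →
              #≤ z (a′ ∷ M) + #≤ (suc z) (up a b ++ X) ≡ #≤ z (a ∷ L) + #≤ z (up a b ++ X)
++-up-shift {a} {b = b} {M} {X} {L} {z} refl eq = begin
  𝟙≤ (a + b) z + #≤ z M + #≤ (suc z) (up a b ++ X)                 ≡⟨ cong (𝟙≤ (a + b) z + #≤ z M +_) (#≤-++ (suc z) (up a b) X) ⟩
  𝟙≤ (a + b) z + #≤ z M + (#≤ (suc z) (up a b) + #≤ (suc z) X)     ≡⟨ interchange (𝟙≤ (a + b) z) _ _ _ ⟩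
  𝟙≤ (a + b) z + #≤ (suc z) (up a b) + (#≤ z M + #≤ (suc z) X)     ≡⟨ cong₂ _+_ (#≤-up-shift a b z) eq ⟩
  𝟙≤ a z + #≤ z (up a b) + (#≤ z L + #≤ z X)                       ≡⟨ interchange (𝟙≤ a z) _ _ _ ⟩
  𝟙≤ a z + #≤ z L + (#≤ z (up a b) + #≤ z X)                       ≡⟨ cong (𝟙≤ a z + #≤ z L +_) (#≤-++ z (up a b) X) ⟨
  𝟙≤ a z + #≤ z L + #≤ z (up a b ++ X)                             ∎
  where
  open ≡-Reasoning

++-down-shift : ∀ {a a′ c B L M z} → c ≤ a → a′ ≡ a ∸ c →
                #≤ z L + #≤ z B ≡ #≤ z M + #≤ (suc z) B →
                #≤ z (a′ ∷ L) + #≤ z (B ++ down a c) ≡ #≤ z (a ∷ M) + #≤ (suc z) (B ++ down a c)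
++-down-shift {a} {c = c} {B} {L} {M} {z} c≤a refl eq = begin
  𝟙≤ (a ∸ c) z + #≤ z L + #≤ z (B ++ down a c)                     ≡⟨ cong (𝟙≤ (a ∸ c) z + #≤ z L +_) (trans (#≤-++ z B (down a c)) (+-comm (#≤ z B) _)) ⟩
  𝟙≤ (a ∸ c) z + #≤ z L + (#≤ z (down a c) + #≤ z B)               ≡⟨ interchange (𝟙≤ (a ∸ c) z) _ _ _ ⟩
  𝟙≤ (a ∸ c) z + #≤ z (down a c) + (#≤ z L + #≤ z B)               ≡⟨ cong₂ _+_ (#≤-down-shift a c z c≤a) eq ⟩
  𝟙≤ a z + #≤ (suc z) (down a c) + (#≤ z M + #≤ (suc z) B)         ≡⟨ interchange (𝟙≤ a z) _ _ _ ⟩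
  𝟙≤ a z + #≤ z M + (#≤ (suc z) (down a c) + #≤ (suc z) B)         ≡⟨ cong (𝟙≤ a z + #≤ z M +_) (trans (#≤-++ (suc z) B (down a c)) (+-comm (#≤ (suc z) B) _)) ⟨
  𝟙≤ a z + #≤ z M + #≤ (suc z) (B ++ down a c)                     ∎
  where
  open ≡-Reasoning

-- Valuations as natural numbers

0≤⊖⇒≤ : ∀ a b → ℤ.0ℤ ℤ.≤ a ℤ.⊖ b → b ≤ a
0≤⊖⇒≤ a b 0≤ with b ≤? a
... | yes b≤a = b≤a
... | no b≰a  = contradiction (subst (ℤ.0ℤ ℤ.≤_) (ℤ.⊖-< (≰⇒> b≰a)) 0≤) (negative (m<n⇒0<n∸m (≰⇒> b≰a)))
  where
  negative : ∀ {d} → 0 < d → ¬ ℤ.0ℤ ℤ.≤ ℤ.- (ℤ.+ d)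
  negative (s≤s _) ()

∣⊖∣-+ : ∀ a b c → ℤ.0ℤ ℤ.≤ a ℤ.⊖ b → ℤ.∣ (a + c) ℤ.⊖ b ∣ ≡ ℤ.∣ a ℤ.⊖ b ∣ + c
∣⊖∣-+ a b c 0≤ = begin
  ℤ.∣ (a + c) ℤ.⊖ b ∣   ≡⟨ cong ℤ.∣_∣ (ℤ.⊖-≥ (≤-trans b≤a (m≤m+n a c))) ⟩
  a + c ∸ b             ≡⟨ +-∸-comm c b≤a ⟩
  a ∸ b + c             ≡⟨ cong (λ x → ℤ.∣ x ∣ + c) (ℤ.⊖-≥ b≤a) ⟨
  ℤ.∣ a ℤ.⊖ b ∣ + c     ∎
  where
  open ≡-Reasoning
  b≤a = 0≤⊖⇒≤ a b 0≤

∣⊖∣-∸ : ∀ a b c → ℤ.0ℤ ℤ.≤ a ℤ.⊖ (b + c) → c ≤ ℤ.∣ a ℤ.⊖ b ∣ × ℤ.∣ a ℤ.⊖ (b + c) ∣ ≡ ℤ.∣ a ℤ.⊖ b ∣ ∸ c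
∣⊖∣-∸ a b c 0≤ rewrite ℤ.⊖-≥ (0≤⊖⇒≤ a (b + c) 0≤) | ℤ.⊖-≥ (≤-trans (m≤m+n b c) (0≤⊖⇒≤ a (b + c) 0≤)) =
  subst (_≤ a ∸ b) (m+n∸m≡n b c) (∸-monoˡ-≤ b (0≤⊖⇒≤ a (b + c) 0≤)) , sym (∸-+-assoc a b c)

∣∣-mono : ∀ {x y} → ℤ.0ℤ ℤ.≤ x → x ℤ.≤ y → ℤ.∣ x ∣ ≤ ℤ.∣ y ∣
∣∣-mono (ℤ.+≤+ _) (ℤ.+≤+ x≤y) = x≤y

module _ {a} {A : Set a} where

  -- `tabulate` adds entries on the left, but insertion reads a new column on the right; this
  -- version grows there.
  prefix : ∀ {k} → ((t : ℕ) → .(t < k) → A) → (t : ℕ) → .(t ≤ k) → List A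
  prefix g zero    _ = []
  prefix g (suc t) p = prefix g t (<⇒≤ p) ++ g t p ∷ []

  prefix-suc : ∀ {k} (g : (t : ℕ) → .(t < suc k) → A) t .(p : suc t ≤ suc k) →
               prefix g (suc t) p ≡ g 0 (s≤s z≤n) ∷ prefix (λ t p → g (suc t) (s≤s p)) t (≤-pred p)
  prefix-suc g zero    p = refl
  prefix-suc g (suc t) p = cong (_++ g (suc t) p ∷ []) (prefix-suc g t (<⇒≤ p))

  tabulate≡prefix : ∀ k (g : (t : ℕ) → .(t < k) → A) →
                    tabulate (λ (j : Fin k) → g (toℕ j) (toℕ<n j)) ≡ prefix g k ≤-refl
  tabulate≡prefix zero    g = refl
  tabulate≡prefix (suc k) g = trans (cong (g 0 (s≤s z≤n) ∷_) (tabulate≡prefix k (λ t p → g (suc t) (s≤s p))))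
                                    (sym (prefix-suc g k ≤-refl))

-- The readings of a fixed tree

module _ {k n : ℕ} (T : GT k n) where
  open GT T

  private
    valuation≥0 : ∀ v .(p : level v ≤ k) → ℤ.0ℤ ℤ.≤ q s v p
    valuation≥0 v p = proj₁ (valuation v (recompute (level v ≤? k) p))

  height : (v : Vertex) → .(level v ≤ k) → ℕ
  height v p = ℤ.∣ q s v p ∣

  height≤n : ∀ v .(p : level v ≤ k) → height v p ≤ n
  height≤n v p = bound (valuation v (recompute (level v ≤? k) p))
    where
    bound : ∀ {x} → ℤ.0ℤ ℤ.≤ x × x ℤ.≤ ℤ.+ n → ℤ.∣ x ∣ ≤ n
    bound (ℤ.+≤+ _ , ℤ.+≤+ x≤n) = x≤n

  lastHeight : (i m : ℕ) .⦃ _ : NonZero i ⦄ → .(i + m ≤ k) → ℕ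
  lastHeight i m p = height (last i m) (last-level i m p)

  height-outer : ∀ i m .⦃ _ : NonZero i ⦄ .(p : i + suc m ≤ k) .(p′ : i + m ≤ k) →
                 height (outer i (suc m)) p ≡ lastHeight i m p′ + s (outer i (suc m)) p
  height-outer i zero    p p′ = refl
  height-outer i (suc m) p p′ = trans
    (cong (λ a → ℤ.∣ a ℤ.⊖ ∑inner s i (suc m) p′ ∣) (sym (+-assoc (s (root i) _) (∑outer s i (suc m) p′) _)))
    (∣⊖∣-+ (s (root i) _ + ∑outer s i (suc m) p′) (∑inner s i (suc m) p′) _ (valuation≥0 (inner i (suc m)) p′))

  height-inner : ∀ i m .⦃ _ : NonZero i ⦄ .(p : i + suc m ≤ k) →
                 s (inner i (suc m)) p ≤ height (outer i (suc m)) p ×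
                 height (inner i (suc m)) p ≡ height (outer i (suc m)) p ∸ s (inner i (suc m)) p
  height-inner i m p = ∣⊖∣-∸ (s (root i) _ + ∑outer s i (suc m) p) (∑inner s i m _) _ (valuation≥0 (inner i (suc m)) p)

  -- All entries belong to level i + m. For m = 0 they are q_i, ..., q_1 of the tree cut off at
  -- level i.
  lastHeights : (i m : ℕ) → .(i + m ≤ k) → List ℕ
  lastHeights zero    m p = []
  lastHeights (suc i) m p = lastHeight (suc i) m p ∷ lastHeights i (suc m) (≤-trans (≤-reflexive (+-suc i m)) p)

  -- `outerHeights` is the state halfway through a reading: the outer vertices of the level are
  -- included, its inner vertices are not.
  outerHeights positives negatives : (i m : ℕ) → .(i + suc m ≤ k) → List ℕ
  outerHeights zero    m p = []
  outerHeights (suc i) m p =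
    height (outer (suc i) (suc m)) p ∷ outerHeights i (suc m) (≤-trans (≤-reflexive (+-suc i (suc m))) p)
  positives zero    m p = []
  positives (suc i) m p =
    up (lastHeight (suc i) m (≤-trans (+-monoʳ-≤ (suc i) (n≤1+n m)) p)) (s (outer (suc i) (suc m)) p) ++
    positives i (suc m) (≤-trans (≤-reflexive (+-suc i (suc m))) p)
  negatives zero    m p = []
  negatives (suc i) m p =
    negatives i (suc m) (≤-trans (≤-reflexive (+-suc i (suc m))) p) ++
    down (height (outer (suc i) (suc m)) p) (s (inner (suc i) (suc m)) p)

  outers≡ : ∀ i m .(p : i + suc m ≤ k) → outers s i m p ≡ map pos (positives i m p)
  outers≡ zero    m p = refl
  outers≡ (suc i) m p = trans (cong₂ _++_ (𝔠⁺≡up _ _) (outers≡ i (suc m) _))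
    (sym (map-++ pos (up _ _) (positives i (suc m) _)))

  inners≡ : ∀ i m .(p : i + suc m ≤ k) → inners s i m p ≡ map bar (negatives i m p)
  inners≡ zero    m p = refl
  inners≡ (suc i) m p = trans (cong₂ _++_ (inners≡ i (suc m) _) (𝔠⁻≡down _ _))
    (sym (map-++ bar (negatives i (suc m) _) (down _ _)))

  #≤-positives : ∀ i m .(p : i + suc m ≤ k) .(p′ : i + m ≤ k) z →
                 #≤ z (outerHeights i m p) + #≤ (suc z) (positives i m p) ≡
                 #≤ z (lastHeights i m p′) + #≤ z (positives i m p)
  #≤-positives zero    m p p′ z = refl
  #≤-positives (suc i) m p p′ z = ++-up-shift
    {lastHeight (suc i) m p′} {b = s (outer (suc i) (suc m)) p} {outerHeights i (suc m) _} {positives i (suc m) _} {lastHeights i (suc m) _} {z}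
    (height-outer (suc i) m p p′) (#≤-positives i (suc m) _ (≤-trans (≤-reflexive (+-suc i m)) p′) z)

  #≤-negatives : ∀ i m .(p : i + suc m ≤ k) z →
                 #≤ z (lastHeights i (suc m) p) + #≤ z (negatives i m p) ≡
                 #≤ z (outerHeights i m p) + #≤ (suc z) (negatives i m p)
  #≤-negatives zero    m p z = refl
  #≤-negatives (suc i) m p z = ++-down-shift
    {B = negatives i (suc m) _} {lastHeights i (suc (suc m)) _} {outerHeights i (suc m) _} {z}
    (proj₁ (height-inner (suc i) m p)) (proj₂ (height-inner (suc i) m p)) (#≤-negatives i (suc m) _ z)

  positives-dominant : ∀ i m .(p : i + suc m ≤ k) .(p′ : i + m ≤ k) {z} → suc z ∈ positives i m p →
                       z ∈ positives i m p ⊎ z ∈ lastHeights i m p′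
  positives-dominant (suc i) m p p′ =
    ++-up-predecessor (positives-dominant i (suc m) _ (≤-trans (≤-reflexive (+-suc i m)) p′))

  negatives-dominant : ∀ i m .(p : i + suc m ≤ k) → Dominant⁻ (outerHeights i m p) (negatives i m p)
  negatives-dominant (suc i) m p =
    ++-down-dominant {B = negatives i (suc m) _} (negatives-dominant i (suc m) _)

  private
    column-at : (t : ℕ) → .(t < k) → ACol n
    column-at t t<k = toACol (ω-level s (suc t) t<k) (columns (suc t) t<k)

    rootHeight : (t : ℕ) → .(suc t ≤ k) → ℕ
    rootHeight t p = s (root (suc t)) p

    +1≤ : ∀ {t} → suc t ≤ k → t + 1 ≤ k
    +1≤ {t} = ≤-trans (≤-reflexive (+-comm t 1))

    +0≤ : ∀ {t} → t ≤ k → t + 0 ≤ k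
    +0≤ {t} = ≤-trans (≤-reflexive (+-identityʳ t))

  module _ (t : ℕ) .(t<k : suc t ≤ k) where

    levelX levelB outerHeights⁺ : List ℕ
    levelX        = up 0 (rootHeight t t<k) ++ positives t 0 (+1≤ t<k)
    levelB        = negatives t 0 (+1≤ t<k)
    outerHeights⁺ = rootHeight t t<k ∷ outerHeights t 0 (+1≤ t<k)

    ω-level≡ : ω-level s (suc t) t<k ≡ map pos levelX ++ map bar levelB
    ω-level≡ = trans (cong₂ _++_ (𝔠⁺≡up 0 (rootHeight t t<k)) (cong₂ _++_ (outers≡ t 0 _) (inners≡ t 0 _)))
      (trans (sym (++-assoc (map pos (up 0 (rootHeight t t<k))) _ _))
        (cong (_++ map bar levelB) (sym (map-++ pos (up 0 (rootHeight t t<k)) _))))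

    level-admissible : map pos levelX ++ map bar levelB ≡ [] ⊎ IsAdmissible n (map pos levelX ++ map bar levelB)
    level-admissible = subst (λ w → w ≡ [] ⊎ IsAdmissible n w) ω-level≡
      (columns (suc t) (recompute (suc t ≤? k) t<k))

    -- The extra empty column of `Raises` is the new strand t + 1, whose root block 12⋯s(t + 1)
    -- starts at height 0.
    level-raises : ∀ {L} → L ≈ lastHeights t 0 (+0≤ (<⇒≤ t<k)) → Raises L levelX outerHeights⁺
    level-raises {L} eq z = begin
      #≤ z outerHeights⁺ + #≤ (suc z) levelX          ≡⟨ ++-up-shift {0} {b = rootHeight t t<k} {outerHeights t 0 _} {positives t 0 _} {lastHeights t 0 _} {z}
                                                          refl (#≤-positives t 0 _ (+0≤ (<⇒≤ t<k)) z) ⟩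
      suc (#≤ z (lastHeights t 0 _) + #≤ z levelX)    ≡⟨ cong (λ x → suc (x + #≤ z levelX)) (eq z) ⟨
      suc (#≤ z L + #≤ z levelX)                      ∎
      where open ≡-Reasoning

    level-dominant⁺ : ∀ {L} → L ≈ lastHeights t 0 (+0≤ (<⇒≤ t<k)) → Dominant⁺ L levelX
    level-dominant⁺ {L} eq s′ with ++-up-predecessor {0} {rootHeight t t<k} {L = lastHeights t 0 (+0≤ (<⇒≤ t<k))}
                                    (positives-dominant t 0 (+1≤ t<k) (+0≤ (<⇒≤ t<k))) s′
    ... | inj₁ p          = inj₁ p
    ... | inj₂ (here p)   = inj₂ (inj₁ p)
    ... | inj₂ (there p)  = inj₂ (inj₂ (∈-resp-≈ {lastHeights t 0 (+0≤ (<⇒≤ t<k))} {L} (sym ∘ eq) p))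

    level-dominant⁻ : Dominant⁻ outerHeights⁺ levelB
    level-dominant⁻ b∈B with negatives-dominant t 0 (+1≤ t<k) b∈B
    ... | inj₁ s′ = inj₁ s′
    ... | inj₂ p  = inj₂ (there p)

    -- The new strand has no inner vertex on this level, so its root height passes through
    -- unchanged.
    level-lowers : ∀ {L} → Lowers outerHeights⁺ levelB L → L ≈ lastHeights (suc t) 0 (+0≤ t<k)
    level-lowers {L} lowers z = +-cancelʳ-≡ (#≤ z levelB) _ _ (begin
      #≤ z L + #≤ z levelB                                                             ≡⟨ lowers z ⟩
      𝟙≤ (rootHeight t t<k) z + #≤ z (outerHeights t 0 _) + #≤ (suc z) levelB          ≡⟨ +-assoc (𝟙≤ (rootHeight t t<k) z) _ _ ⟩
      𝟙≤ (rootHeight t t<k) z + (#≤ z (outerHeights t 0 _) + #≤ (suc z) levelB)        ≡⟨ cong (𝟙≤ (rootHeight t t<k) z +_) (#≤-negatives t 0 (+1≤ t<k) z) ⟨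
      𝟙≤ (rootHeight t t<k) z + (#≤ z (lastHeights t 1 _) + #≤ z levelB)               ≡⟨ +-assoc (𝟙≤ (rootHeight t t<k) z) _ _ ⟨
      𝟙≤ (rootHeight t t<k) z + #≤ z (lastHeights t 1 _) + #≤ z levelB                 ∎)
      where open ≡-Reasoning

  reading : (t : ℕ) → .(t ≤ k) → List (ACol n)
  reading = prefix column-at

  -- The invariant: after t + 1 columns the sorted heights are the valuations at which the t + 1
  -- strands stand on that level. A new column first takes them to the outer valuations and then to
  -- the inner ones.
  sort-reading : ∀ t .(t<k : suc t ≤ k) →
                 ∃[ S ] heights {n} {reading (suc t) t<k} S ≈ lastHeights (suc t) 0 (+0≤ t<k)
  sort-reading zero t<k =
    sorting ([] ∷ []) (height≤n (root 1) t<k ∷ [])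
      (≡⇒⟶* (cong (_∷ []) (toACol-cong (++-identityʳ (𝔠⁺ 0 (rootHeight 0 t<k)))))) ,
    λ _ → refl
  sort-reading (suc t) t<k with sort-reading t (<⇒≤ t<k)
  -- There is at least one strand, so the list of heights has a top column to insert into.
  ... | sorting {[]} _ _ _ , eq = contradiction (∈-resp-≈ {lastHeights (suc t) 0 (+0≤ (<⇒≤ t<k))} {[]} (sym ∘ eq) (here refl)) λ ()
  ... | S@(sorting {p ∷ L} dL aL red) , eq =
    let a       = level-admissible (suc t) t<k
        S′ , lo = insert-column p L aL dL (toPair (levelX (suc t) t<k) (levelB (suc t) t<k) a) a
                    (level-dominant⁺ (suc t) t<k {p ∷ L} eq) (level-raises (suc t) t<k {p ∷ L} eq) (level-dominant⁻ (suc t) t<k)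
    in sorting (descending S′) (heights≤n S′)
         (⟶*-++ʳ (column-at (suc t) t<k ∷ []) red ◅◅
          ≡⇒⟶* (cong (λ c → cols (p ∷ L) aL ++ c ∷ []) (toACol-cong (ω-level≡ (suc t) t<k))) ◅◅
          reduces S′)
     , level-lowers (suc t) t<k {heights S′} lo

  ω≡reading : ω T ≡ reading k ≤-refl
  ω≡reading = tabulate≡prefix k column-at

  lastHeights≤n : ∀ i m .(p : i + m ≤ k) → All (_≤ n) (lastHeights i m p)
  lastHeights≤n zero    m p = []
  lastHeights≤n (suc i) m p = height≤n (last (suc i) m) (last-level (suc i) m p) ∷ lastHeights≤n i (suc m) (≤-trans (≤-reflexive (+-suc i m)) p)

  private
    𝔠q : ∀ i → .(i ≤ k) → (j : Fin i) → ACol n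
    𝔠q i i≤k j = 𝔠qᵢ T (i ∸ toℕ j) ⦃ >-nonZero (m<n⇒0<n∸m (toℕ<n j)) ⦄ (≤-trans (m∸n≤m i (toℕ j)) i≤k)

  -- The equation i + m = k identifies the running index m with the truncated difference k ∸ i in
  -- the definition of q_i.
  tabulate-𝔠q : ∀ i m .(p : i + m ≤ k) .(i≤k : i ≤ k) → i + m ≡ k →
                tabulate (𝔠q i i≤k) ≡ row (lastHeights i m p) (lastHeights≤n i m p)
  tabulate-𝔠q zero    m p i≤k eq = refl
  tabulate-𝔠q (suc i) m p i≤k eq = cong₂ _∷_
    (toACol-cong (cong (𝔠⁺ 0) (same-height k∸i≡m (≤-reflexive (m+[n∸m]≡n i≤k)) p)))
    (tabulate-𝔠q i (suc m) (≤-trans (≤-reflexive (+-suc i m)) p) (<⇒≤ i≤k) (trans (+-suc i m) eq))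
    where
    k∸i≡m : k ∸ suc i ≡ m
    k∸i≡m = trans (cong (_∸ suc i) (sym eq)) (m+n∸m≡n (suc i) m)
    same-height : ∀ {m m′} → m ≡ m′ → .(p : suc i + m ≤ k) .(p′ : suc i + m′ ≤ k) →
                  lastHeight (suc i) m p ≡ lastHeight (suc i) m′ p′
    same-height refl _ _ = refl

  ∏𝔠q-sorted : (∀ i .⦃ _ : NonZero i ⦄ (i<k : i < k) → qᵢ T (suc i) i<k ℤ.≤ qᵢ T i (<⇒≤ i<k)) →
               Linked (flip _⪯_) (∏𝔠q T)
  ∏𝔠q-sorted chain = sorted k ≤-refl
    where
    end : ∀ i .⦃ _ : NonZero i ⦄ → i ≤ k → level (last i (k ∸ i)) ≤ k
    end i i≤k = last-level i (k ∸ i) (≤-reflexive (m+[n∸m]≡n i≤k))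
    sorted : ∀ i (i≤k : i ≤ k) → Linked (flip _⪯_) (tabulate (𝔠q i i≤k))
    sorted zero          i≤k = []
    sorted (suc zero)    i≤k = [-]
    sorted (suc (suc i)) i≤k =
      𝔠-antitone (height≤n (last (suc i) (k ∸ suc i)) (end (suc i) (<⇒≤ i≤k))) (height≤n (last (2+ i) (k ∸ 2+ i)) (end (2+ i) i≤k))
        (∣∣-mono (valuation≥0 (last (2+ i) (k ∸ 2+ i)) (end (2+ i) i≤k)) (chain (suc i) i≤k)) ∷ sorted (suc i) (<⇒≤ i≤k)

star-normal : ∀ {n} {cs ds : List (ACol n)} → IsNormalForm _⟶_ cs → cs ⟶* ds → cs ≡ ds
star-normal nf Star.ε  = refl
star-normal nf (r ◅ _) = contradiction (_ , r) nf

-- The product follows the strands, so it can itself be reducible: for k = 2, n ≥ 1, s(2) = 1 and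
-- all other labels 0, ω(T) is the normal word ε𝔠(1), while the product is 𝔠(1)ε. Hence the two
-- words are compared through a common normal form, and they are equated with the product itself
-- under q_k ≤ ⋯ ≤ q_1, which makes the product normal.
theorem5p1 : (n k : ℕ) → 1 ≤ k → (T : GT k n) →
    (∃[ v ] (ω T HasNormalForm v × ∏𝔠q T HasNormalForm v))
    × ((∀ i .⦃ _ : NonZero i ⦄ (i<k : i < k) → qᵢ T (suc i) i<k ℤ.≤ qᵢ T i (<⇒≤ i<k)) →
    ω T HasNormalForm ∏𝔠q T)
theorem5p1 n k@(suc t) 1≤k T = (v , (ω→v , v-normal) , (∏→v , v-normal)) , sorted-case
  where
  H = lastHeights T k 0 (≤-reflexive (+-identityʳ k))
  H≤n = lastHeights≤n T k 0 (≤-reflexive (+-identityʳ k))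
  ω-sorting = sort-reading T t ≤-refl
  ∏-sorting = sort-row H H≤n
  S = proj₁ ω-sorting
  S′ = proj₁ ∏-sorting
  v = cols (heights S) (heights≤n S)
  v-normal : IsNormalForm _⟶_ v
  v-normal = cols-normal (heights S) (heights≤n S) (descending S)
  ω→v : ω T ⟶* v
  ω→v = ≡⇒⟶* (ω≡reading T) ◅◅ reduces S
  ∏→v : ∏𝔠q T ⟶* v
  ∏→v = ≡⇒⟶* (tabulate-𝔠q T k 0 (≤-reflexive (+-identityʳ k)) ≤-refl (+-identityʳ k)) ◅◅ reduces S′ ◅◅
    -- Both sortings carry the multiset of the final strand valuations, and a descending list is
    -- determined by its multiset.
    ≡⇒⟶* (cols-unique {aL = heights≤n S′} {heights≤n S} (descending S′) (descending S)
      (λ z → trans (proj₂ ∏-sorting z) (sym (proj₂ ω-sorting z))))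
  sorted-case : (∀ i .⦃ _ : NonZero i ⦄ (i<k : i < k) → qᵢ T (suc i) i<k ℤ.≤ qᵢ T i (<⇒≤ i<k)) →
                ω T HasNormalForm ∏𝔠q T
  -- A normal product that reduces to v is v, so the reduction of ω(T) to v already ends at the
  -- product.
  sorted-case chain = subst (ω T ⟶*_) (sym (star-normal ∏-normal ∏→v)) ω→v , ∏-normal
    where
    ∏-normal : IsNormalForm _⟶_ (∏𝔠q T)
    ∏-normal = normal (∏𝔠q-sorted T chain)
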